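{- Let $\mathbb{A}$ be a finite alphabet and let $F$ be a cost function described by an $\mathrm{LTL}^{\le}$-formula over $\mathbb{A}$, i.e. $F=[\![\varphi]\!]^{\approx}$ for some $\mathrm{LTL}^{\le}$-formula $\varphi$. Then $F$ is regular and the syntactic stabilization semigroup of $F$ is aperiodic.
   Context: **Cost functions.** A set $X\subseteq\mathbb{N}_\infty=\mathbb{N}\cup\{\infty\}$ is bounded if some $N\in\mathbb{N}$ satisfies $x<N$ for all $x\in X$. For $\mathbb{N}_\infty$-valued functions $f,g$ on words, $f\approx g$ means that for every set $W$ of words, $f(W)$ is bounded iff $g(W)$ is bounded. A cost function is a $\approx$-class; $f^{\approx}$ is the class of $f$. For recognition by semigroups, functions are considered on nonempty words $\mathbb{A}^+$. **$\mathrm{LTL}^{\le}$ (on finite words).** Formulas: $\varphi::=a\mid\varphi\wedge\varphi\mid\varphi\vee\varphi\mid X\varphi\mid\varphi U\varphi\mid\varphi U^{\le N}\varphi\mid\Omega$, with $a\in\mathbb{A}$, where $N$ is a single free variable common to all occurrences of $U^{\le N}$. For $u\in\mathbb{A}^*$, $n\in\mathbb{N}$: $(u,n)\models a$ iff $u\in a\mathbb{A}^*$; $(u,n)\models\Omega$ iff $u$ is empty; $\wedge,\vee$ are conjunction and disjunction; $(u,n)\models X\varphi$ iff $u=av$ with $a\in\mathbb{A}$ and $(v,n)\models\varphi$; $(u,n)\models\varphi U\psi$ iff $u=yz$ with $(z,n)\models\psi$ and $(y''z,n)\models\varphi$ for every nonempty suffix $y''$ of $y$ ($y,z$ may be empty);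 $(u,n)\models\varphi U^{\le N}\psi$ iff $u=yz$ with $(z,n)\models\psi$ and $(y''z,n)\not\models\varphi$ for at most $n$ nonempty suffixes $y''$ of $y$. $[\![\varphi]\!](u)=\inf\{n:(u,n)\models\varphi\}$, $\inf\emptyset=\infty$. **Stabilization semigroups (finite).** $\mathbf{S}=\langle S,\cdot,\le,\sharp\rangle$ where $\langle S,\cdot\rangle$ is a finite semigroup, $\le$ a partial order compatible with the product, and $\sharp$ maps the set $E(\mathbf{S})$ of idempotents to itself such that: if $a\cdot b,b\cdot a\in E(\mathbf{S})$ then $(a\cdot b)^\sharp=a\cdot(b\cdot a)^\sharp\cdot b$; $(e^\sharp)^\sharp=e^\sharp\le e$ for $e\in E(\mathbf{S})$; $e\le f$ in $E(\mathbf{S})$ implies $e^\sharp\le f^\sharp$; and if $\mathbf{S}$ is a monoid, $1^\sharp=1$. An ideal is a $\le$-downward closed subset. For $n\in\mathbb{N}$ and $u\in S^+$, an $n$-tree over $u$ is an $S$-labelled tree $t$ with leaf word $u$ in which every node $p$ is: a leaf; or binary, with children $p_1,p_2$ and $t(p)=t(p_1)\cdot t(p_2)$; or idempotent, with $k\le n$ children all labelled by one idempotent $e$, and $t(p)=e$; or stabilization, with $k>n$ children all labelled by one idempotent $e$, and $t(p)=e^\sharp$. $\mathrm{val}(t)$ is the root label. There is $H\in\mathbb{N}$ such that every $u\in S^+$ has, for every $n$, an $n$-tree of height at most $H$; put $\rho(u)(n)=\min\{\mathrm{val}(t):t\text{ an }n\text{ -tree over }u\text{ of height}\le H\}$ (if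 there is no least element, choose a minimal one; the choice of such values and of $H$ does not affect the recognized cost function). Given $h:\mathbb{A}\to S$ (extended letterwise to $h:\mathbb{A}^+\to S^+$) and an ideal $I$, the triple $\mathbf{S},h,I$ recognizes the cost function of $u\mapsto\inf\{n\in\mathbb{N}:\rho(h(u))(n)\notin I\}$. $\mathbf{S}$ recognizes $F$ if this holds for some $h,I$. A cost function is regular iff it is recognized by a finite stabilization semigroup. **Syntactic stabilization semigroup.** For a regular $F$, the syntactic stabilization semigroup $\mathbf{S}_F$ is the minimal stabilization semigroup recognizing $F$: it is generated by the images of the letters under $\cdot$ and $\sharp$, and is a quotient of every stabilization semigroup recognizing $F$ (restricted to the part generated by the images of letters); it is unique up to isomorphism. **Aperiodicity.** A finite (stabilization) semigroup is aperiodic if there is $k$ such that $s^{k+1}=s^k$ for all its elements $s$. -}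

module Defs where

open import Algebra.Definitions using (_IdempotentOn_; Identity)
open import Algebra.Structures using (IsSemigroup)
open import Data.Fin using (Fin)
open import Data.Fin.Properties using (inj⇒≟)
open import Data.List using (List; []; _∷_; _++_; length; filter)
open import Data.List.Properties using (length-filter; length-++)
open import Data.List.NonEmpty as List⁺ using (List⁺; _⁺++⁺_)
open import Data.List.Relation.Unary.All as All using (All; all?)
open import Data.Nat using (ℕ; zero; suc; _≤_; _<_; _⊔_; z≤n; s≤s; _≤?_)
open import Data.Nat.Properties
  using (≤-refl; ≤-trans; ≤-reflexive; n≤1+n; m≤m+n; m≤n+m; +-monoˡ-≤; m≤n⇒m≤1+n; ≮⇒≥; m<1+n⇒m<n∨m≡n; <⇒≱)
open import Data.Product using (∃₂; ∃-syntax; Σ-syntax; _×_; _,_; proj₁; proj₂)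
open import Data.Sum using (_⊎_; inj₁; inj₂)
open import Data.Empty using (⊥-elim)
open import Function using (_∘_; _↔_; _⇔_)
open import Function.Properties.Inverse using (↔⇒↣)
open import Level using (0ℓ)
open import Relation.Binary using (Rel; IsPartialOrder; DecidableEquality; _Preserves₂_⟶_⟶_)
open import Relation.Binary.PropositionalEquality using (_≡_; refl; sym; cong)
open import Relation.Nullary using (¬_; Dec; yes; no; ¬?; _×-dec_; _⊎-dec_)
open import Relation.Nullary.Decidable using (map′)
open import Relation.Nullary.Construct.Add.Supremum using (_⁺; ⊤⁺; [_])
open import Relation.Unary using (Pred; Decidable; _∈_; _∉_)
import Relation.Binary.Construct.Add.Supremum.Strict as StrictSup

Finite : Set → Set
Finite X = ∃[ m ] (X ↔ Fin m)

finite⇒≟ : ∀ {X} → Finite X → DecidableEquality X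
finite⇒≟ (m , X↔Fin) = inj⇒≟ (↔⇒↣ X↔Fin)

ℕ∞ : Set
ℕ∞ = ℕ ⁺

open StrictSup _<_ public using (_<⁺_)

data IsInf (P : Pred ℕ 0ℓ) : ℕ∞ → Set where
  minimum : ∀ {n} → P n → (∀ m → P m → n ≤ m) → IsInf P [ n ]
  empty   : (∀ n → ¬ P n) → IsInf P ⊤⁺

BoundedOn : {X : Set} → (X → ℕ∞) → Pred X 0ℓ → Set
BoundedOn f W = ∃[ N ] (∀ x → x ∈ W → f x <⁺ [ N ])

-- Cost functions, i.e. classes for _≈_, are given by arbitrary representatives.
infix 4 _≈_
_≈_ : {X : Set} → (X → ℕ∞) → (X → ℕ∞) → Set₁
_≈_ {X} f g = (W : Pred X 0ℓ) → BoundedOn f W ⇔ BoundedOn g W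

infixr 6 _∧_
infixr 5 _∨_
infixr 7 _U_ _U≤N_

data LTL≤ (A : Set) : Set where
  atom : A → LTL≤ A
  _∧_ _∨_ _U_ _U≤N_ : LTL≤ A → LTL≤ A → LTL≤ A
  X : LTL≤ A → LTL≤ A
  Ω : LTL≤ A

nonEmptySuffixes : {A : Set} → List A → List (List A)
nonEmptySuffixes []      = []
nonEmptySuffixes (a ∷ y) = (a ∷ y) ∷ nonEmptySuffixes y

splitting? : {A : Set} {P : List A → List A → Set} → (∀ y z → Dec (P y z)) →
             ∀ u → Dec (∃₂ λ y z → u ≡ y ++ z × P y z)
splitting? P? u with P? [] u
splitting? P? u       | yes p = yes ([] , u , refl , p)
splitting? P? []      | no ¬p = no λ { ([] , [] , refl , p) → ¬p p }
splitting? P? (a ∷ u) | no ¬p = map′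
  (λ { (y , z , refl , p) → a ∷ y , z , refl , p })
  (λ { ([] , _ , refl , p) → ⊥-elim (¬p p)
     ; (_ ∷ y , z , refl , p) → y , z , refl , p })
  (splitting? (λ y z → P? (a ∷ y) z) u)

length-filter-antitone :
  {X : Set} {P Q : Pred X 0ℓ} (P? : Decidable P) (Q? : Decidable Q) (xs : List X) →
  All (λ x → P x → Q x) xs →
  length (filter (¬? ∘ Q?) xs) ≤ length (filter (¬? ∘ P?) xs)
length-filter-antitone P? Q? [] All.[] = z≤n
length-filter-antitone P? Q? (x ∷ xs) (i All.∷ is) with P? x | Q? x
... | yes p | yes q = length-filter-antitone P? Q? xs is
... | yes p | no ¬q = ⊥-elim (¬q (i p))
... | no ¬p | yes q = m≤n⇒m≤1+n (length-filter-antitone P? Q? xs is)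
... | no ¬p | no ¬q = s≤s (length-filter-antitone P? Q? xs is)

length-nonEmptySuffixes : {A : Set} (y : List A) → length (nonEmptySuffixes y) ≡ length y
length-nonEmptySuffixes []      = refl
length-nonEmptySuffixes (a ∷ y) = cong suc (length-nonEmptySuffixes y)

nonEmptySuffixes-short : {A : Set} (y : List A) →
  All (λ y″ → length y″ ≤ length y) (nonEmptySuffixes y)
nonEmptySuffixes-short []      = All.[]
nonEmptySuffixes-short (a ∷ y) =
  ≤-refl All.∷ All.map m≤n⇒m≤1+n (nonEmptySuffixes-short y)

least : ∀ {P : Pred ℕ 0ℓ} → Decidable P → ∀ b →
        (∃[ n ] (P n × (∀ m → P m → n ≤ m))) ⊎ (∀ m → m < b → ¬ P m)
least P? zero = inj₂ λ _ ()
least {P} P? (suc b) with least P? b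
... | inj₁ found = inj₁ found
... | inj₂ none with P? b
...   | yes p = inj₁ (b , p , λ m q → ≮⇒≥ (λ m<b → none m m<b q))
...   | no ¬p = inj₂ λ m m<1+b q → case-≤ (m<1+n⇒m<n∨m≡n m<1+b) q
  where
  case-≤ : ∀ {m} → m < b ⊎ m ≡ b → ¬ P m
  case-≤ (inj₁ m<b)  q = none _ m<b q
  case-≤ (inj₂ refl) q = ¬p q

tail-bound : {A : Set} (y z : List A) {n m : ℕ} →
  n ≤ m ⊎ length (y ++ z) ≤ m → n ≤ m ⊎ length z ≤ m
tail-bound y z (inj₁ n≤m) = inj₁ n≤m
tail-bound y z (inj₂ l≤m) = inj₂ (≤-trans (m≤n+m (length z) (length y))
  (≤-trans (≤-reflexive (sym (length-++ y))) l≤m))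

suffix-bound : {A : Set} (y z y″ : List A) {n m : ℕ} →
  n ≤ m ⊎ length (y ++ z) ≤ m → length y″ ≤ length y → n ≤ m ⊎ length (y″ ++ z) ≤ m
suffix-bound y z y″ (inj₁ n≤m) _ = inj₁ n≤m
suffix-bound y z y″ (inj₂ l≤m) short = inj₂ (≤-trans (≤-reflexive (length-++ y″))
  (≤-trans (+-monoˡ-≤ (length z) short) (≤-trans (≤-reflexive (sym (length-++ y))) l≤m)))

module Semantics {A : Set} (finite : Finite A) where

  private
    _≟_ : DecidableEquality A
    _≟_ = finite⇒≟ finite

  infix 4 _,_⊨_ _,_⊨?_

  _,_⊨_  : List A → ℕ → LTL≤ A → Set
  _,_⊨?_ : ∀ u n φ → Dec (u , n ⊨ φ)

  u , n ⊨ atom a = ∃[ v ] u ≡ a ∷ v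
  u , n ⊨ Ω      = u ≡ []
  u , n ⊨ φ ∧ ψ  = (u , n ⊨ φ) × (u , n ⊨ ψ)
  u , n ⊨ φ ∨ ψ  = (u , n ⊨ φ) ⊎ (u , n ⊨ ψ)
  u , n ⊨ X φ    = ∃₂ λ a v → u ≡ a ∷ v × (v , n ⊨ φ)
  u , n ⊨ φ U ψ  = ∃₂ λ y z → u ≡ y ++ z × (z , n ⊨ ψ) ×
    All (λ y″ → y″ ++ z , n ⊨ φ) (nonEmptySuffixes y)
  -- The non-empty suffixes of y have pairwise distinct lengths, so the length
  -- of the filtered list is the number of suffixes at which φ fails.
  u , n ⊨ φ U≤N ψ = ∃₂ λ y z → u ≡ y ++ z × (z , n ⊨ ψ) ×
    length (filter (λ y″ → ¬? (y″ ++ z , n ⊨? φ)) (nonEmptySuffixes y)) ≤ n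

  [] , n ⊨? atom a      = no λ ()
  (b ∷ u) , n ⊨? atom a = map′ (λ { refl → u , refl }) (λ { (_ , refl) → refl }) (b ≟ a)
  [] , n ⊨? Ω           = yes refl
  (b ∷ u) , n ⊨? Ω      = no λ ()
  u , n ⊨? φ ∧ ψ        = (u , n ⊨? φ) ×-dec (u , n ⊨? ψ)
  u , n ⊨? φ ∨ ψ        = (u , n ⊨? φ) ⊎-dec (u , n ⊨? ψ)
  [] , n ⊨? X φ         = no λ ()
  (b ∷ u) , n ⊨? X φ    = map′ (λ s → b , u , refl , s) (λ { (_ , _ , refl , s) → s }) (u , n ⊨? φ)
  u , n ⊨? φ U ψ        = splitting? (λ y z → (z , n ⊨? ψ) ×-dec
    all? (λ y″ → y″ ++ z , n ⊨? φ) (nonEmptySuffixes y)) u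
  u , n ⊨? φ U≤N ψ      = splitting? (λ y z → (z , n ⊨? ψ) ×-dec
    (length (filter (λ y″ → ¬? (y″ ++ z , n ⊨? φ)) (nonEmptySuffixes y)) ≤? n)) u

  -- Satisfaction is monotone in n, and n = length u already decides whether
  -- (u , n) satisfies φ for some n.
  ⊨-stable : ∀ φ {u n m} → n ≤ m ⊎ length u ≤ m → u , n ⊨ φ → u , m ⊨ φ
  ⊨-stable (atom a) _ s = s
  ⊨-stable Ω        _ s = s
  ⊨-stable (φ ∧ ψ) c (s , t)  = ⊨-stable φ c s , ⊨-stable ψ c t
  ⊨-stable (φ ∨ ψ) c (inj₁ s) = inj₁ (⊨-stable φ c s)
  ⊨-stable (φ ∨ ψ) c (inj₂ t) = inj₂ (⊨-stable ψ c t)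
  ⊨-stable (X φ) (inj₁ n≤m) (a , v , refl , s) = a , v , refl , ⊨-stable φ (inj₁ n≤m) s
  ⊨-stable (X φ) (inj₂ l≤m) (a , v , refl , s) =
    a , v , refl , ⊨-stable φ (inj₂ (≤-trans (n≤1+n _) l≤m)) s
  ⊨-stable (φ U ψ) c (y , z , refl , t , ss) =
    y , z , refl , ⊨-stable ψ (tail-bound y z c) t ,
    All.zipWith (λ { {y″} (short , s) → ⊨-stable φ (suffix-bound y z y″ c short) s })
      (nonEmptySuffixes-short y , ss)
  ⊨-stable (φ U≤N ψ) {n = n} {m} c (y , z , refl , t , few) =
    y , z , refl , ⊨-stable ψ (tail-bound y z c) t , few′ c
    where
    fails? : ∀ k y″ → Dec (¬ (y″ ++ z , k ⊨ φ))
    fails? k y″ = ¬? (y″ ++ z , k ⊨? φ)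

    few′ : n ≤ m ⊎ length (y ++ z) ≤ m → length (filter (fails? m) (nonEmptySuffixes y)) ≤ m
    few′ (inj₁ n≤m) = ≤-trans
      (length-filter-antitone (λ y″ → y″ ++ z , n ⊨? φ) (λ y″ → y″ ++ z , m ⊨? φ)
        (nonEmptySuffixes y) (All.universal (λ _ → ⊨-stable φ (inj₁ n≤m)) _))
      (≤-trans few n≤m)
    few′ (inj₂ l≤m) = ≤-trans (length-filter (fails? m) (nonEmptySuffixes y))
      (≤-trans (≤-reflexive (length-nonEmptySuffixes y))
      (≤-trans (m≤m+n (length y) (length z))
      (≤-trans (≤-reflexive (sym (length-++ y))) l≤m)))

  inf⊨ : ∀ φ u → Σ[ v ∈ ℕ∞ ] IsInf (λ n → u , n ⊨ φ) v
  inf⊨ φ u with least (λ n → u , n ⊨? φ) (suc (length u))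
  ... | inj₁ (n , s , min) = [ n ] , minimum s min
  ... | inj₂ none = ⊤⁺ , empty λ n s → none (length u) ≤-refl (⊨-stable φ (inj₂ ≤-refl) s)

  ⟦_⟧ : LTL≤ A → List A → ℕ∞
  ⟦ φ ⟧ u = proj₁ (inf⊨ φ u)

-- The law 1♯ = 1 is not a field: it belongs to the monoid signature and is
-- not inherited by subsemigroups having a neutral element of their own. For
-- instance u ↦ |u| over a one-letter alphabet is recognized by {1, a, 0} with
-- a♯ = 0, whose part generated by the letter is {a, 0}, with neutral element a
-- and a♯ ≠ a. The law is the separate predicate NeutralStable.
record StabilizationSemigroup : Set₁ where
  infixl 7 _∙_
  infix  8 _♯[_]
  infix  4 _≤ˢ_
  field
    Carrier        : Set
    finite         : Finite Carrier
    _∙_            : Carrier → Carrier → Carrier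
    isSemigroup    : IsSemigroup _≡_ _∙_
    _≤ˢ_           : Rel Carrier 0ℓ
    isPartialOrder : IsPartialOrder _≡_ _≤ˢ_
    ∙-mono         : _∙_ Preserves₂ _≤ˢ_ ⟶ _≤ˢ_ ⟶ _≤ˢ_

  IsIdem : Carrier → Set
  IsIdem e = _IdempotentOn_ _≡_ _∙_ e

  field
    _♯[_]  : ∀ e → IsIdem e → Carrier
    ♯-idem : ∀ {e} (i : IsIdem e) → IsIdem (e ♯[ i ])
    ♯-conj : ∀ {a b} (i : IsIdem (a ∙ b)) (j : IsIdem (b ∙ a)) →
             (a ∙ b) ♯[ i ] ≡ a ∙ (b ∙ a) ♯[ j ] ∙ b
    ♯-♯    : ∀ {e} (i : IsIdem e) → (e ♯[ i ]) ♯[ ♯-idem i ] ≡ e ♯[ i ]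
    ♯-≤    : ∀ {e} (i : IsIdem e) → e ♯[ i ] ≤ˢ e
    ♯-mono : ∀ {e f} (i : IsIdem e) (j : IsIdem f) → e ≤ˢ f → e ♯[ i ] ≤ˢ f ♯[ j ]

  NeutralStable : Set
  NeutralStable = ∀ {ε} → Identity _≡_ ε _∙_ → (i : IsIdem ε) → ε ♯[ i ] ≡ ε

  -- s ^1+ n is the (n+1)-st power of s.
  _^1+_ : Carrier → ℕ → Carrier
  s ^1+ zero  = s
  s ^1+ suc n = s ∙ (s ^1+ n)

  Aperiodic : Set
  Aperiodic = ∃[ k ] (∀ s → s ^1+ suc k ≡ s ^1+ k)

  record Ideal : Set₁ where
    field
      member     : Pred Carrier 0ℓ
      downClosed : ∀ {s t} → s ≤ˢ t → t ∈ member → s ∈ member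

  -- Tree n u s is the type of n-trees over u with value s, and Forest n e k u
  -- that of sequences of k ≥ 1 such trees, all of value e, whose leaf words
  -- concatenate to u.
  data Tree (n : ℕ) : List⁺ Carrier → Carrier → Set
  data Forest (n : ℕ) (e : Carrier) : ℕ → List⁺ Carrier → Set

  data Tree n where
    leaf          : ∀ s → Tree n List⁺.[ s ] s
    binary        : ∀ {u v s t} → Tree n u s → Tree n v t → Tree n (u ⁺++⁺ v) (s ∙ t)
    idempotent    : ∀ {u e k} → IsIdem e → k ≤ n → Forest n e k u → Tree n u e
    stabilization : ∀ {u e k} (i : IsIdem e) → n < k → Forest n e k u → Tree n u (e ♯[ i ])

  data Forest n e where
    one : ∀ {u} → Tree n u e → Forest n e 1 u
    _∷_ : ∀ {u v k} → Tree n u e → Forest n e k v → Forest n e (suc k) (u ⁺++⁺ v)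

  height   : ∀ {n u s} → Tree n u s → ℕ
  heightᶠ  : ∀ {n e k u} → Forest n e k u → ℕ
  height (leaf _)               = 0
  height (binary t t′)          = suc (height t ⊔ height t′)
  height (idempotent _ _ ts)    = suc (heightᶠ ts)
  height (stabilization _ _ ts) = suc (heightᶠ ts)
  heightᶠ (one t)  = height t
  heightᶠ (t ∷ ts) = height t ⊔ heightᶠ ts

  -- ρ u n is a minimal (hence the least, if there is one) value of an n-tree
  -- over u of height at most H; attained also says that such trees exist.
  record IsValuation (H : ℕ) (ρ : List⁺ Carrier → ℕ → Carrier) : Set where
    field
      attained : ∀ u n → Σ[ t ∈ Tree n u (ρ u n) ] height t ≤ H
      minimal  : ∀ u n {s} (t : Tree n u s) → height t ≤ H → s ≤ˢ ρ u n → s ≡ ρ u n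

open StabilizationSemigroup using (Carrier; Aperiodic; NeutralStable; Ideal)

module _ {A : Set} where

  record Recognizes (S : StabilizationSemigroup) (h : A → Carrier S) (I : Ideal S)
                    (f : List⁺ A → ℕ∞) : Set₁ where
    open StabilizationSemigroup S using (IsValuation; module Ideal)
    field
      H           : ℕ
      ρ           : List⁺ (Carrier S) → ℕ → Carrier S
      isValuation : IsValuation H ρ
      g           : List⁺ A → ℕ∞
      isInf       : ∀ u → IsInf (λ n → ρ (List⁺.map h u) n ∉ Ideal.member I) (g u)
      f≈g         : f ≈ g

  Regular : (List⁺ A → ℕ∞) → Set₁
  Regular f = Σ[ S ∈ StabilizationSemigroup ] NeutralStable S ×
    (∃₂ λ h I → Recognizes S h I f)

  data Generated (S : StabilizationSemigroup) (h : A → Carrier S) : Carrier S → Set where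
    letter  : ∀ a → Generated S h (h a)
    product : ∀ {s t} → Generated S h s → Generated S h t →
              Generated S h (StabilizationSemigroup._∙_ S s t)
    sharp   : ∀ {e} (i : StabilizationSemigroup.IsIdem S e) → Generated S h e →
              Generated S h (StabilizationSemigroup._♯[_] S e i)

  -- A surjective morphism of stabilization semigroups, compatible with the
  -- letters, from the part of S generated by the letters onto T. By mono and
  -- antisymmetry, η does not depend on the derivation of Generated S h s.
  record Quotient (S : StabilizationSemigroup) (h : A → Carrier S)
                  (T : StabilizationSemigroup) (h′ : A → Carrier T) : Set where
    private
      module S = StabilizationSemigroup S
      module T = StabilizationSemigroup T
    field
      η        : ∀ {s} → Generated S h s → Carrier T
      η-letter : ∀ a → η (letter a) ≡ h′ a
      η-∙      : ∀ {s t} (p : Generated S h s) (q : Generated S h t) →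
                 η (product p q) ≡ η p T.∙ η q
      η-♯      : ∀ {e} (i : S.IsIdem e) (p : Generated S h e) (j : T.IsIdem (η p)) →
                 η (sharp i p) ≡ (η p) T.♯[ j ]
      mono     : ∀ {s t} (p : Generated S h s) (q : Generated S h t) →
                 s S.≤ˢ t → η p T.≤ˢ η q
      onto     : ∀ x → ∃₂ λ s (p : Generated S h s) → η p ≡ x

  -- T is not required to be NeutralStable: with the example u ↦ |u| above, the
  -- syntactic object is {a, 0}.
  record IsSyntactic (T : StabilizationSemigroup) (f : List⁺ A → ℕ∞) : Set₁ where
    field
      h          : A → Carrier T
      I          : Ideal T
      recognizes : Recognizes T h I f
      generated  : ∀ x → Generated T h x
      quotient   : ∀ S → NeutralStable S → ∀ h′ I′ → Recognizes S h′ I′ f →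
                   Quotient S h′ T h

{-# OPTIONS --safe #-}

-- Reading a word from the right, the truth values of the subformulas of φ are
-- computed by a cascade: each letter acts on the counter of a subformula by one
-- of the four actions below, chosen from the truth values of its operands; only
-- U≤N uses inc. A word is abstracted to the element (f₁ , … , f_k) of an iterated
-- wreath product, where f_i maps the truth values of the components below i to an
-- action on the i-th counter. The actions form a band, so the cascade is aperiodic,
-- and (e , f) ♯ iterates f once the lower components have settled in e ♯ q.
-- The value of an n-tree of height h bounds the counters in both directions: from
-- above with error (2 + n) ^ h, from below as soon as n exceeds the time needed
-- by the counters of all levels to overflow one after the other. Trees of bounded
-- height exist by a factorization forest argument, by induction on the size of
-- principal ideals.
module Submission where

open import Defs
open import Algebra.Definitions using (Identity)
open import Algebra.Structures using (IsSemigroup)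
open import Data.Bool using (Bool; true; false; T; T?; if_then_else_) renaming (_∧_ to _&&_; _∨_ to _||_)
open import Data.Bool.Properties using (T-∧; T-∨)
open import Data.Empty using (⊥-elim)
open import Data.Fin using (Fin; zero; suc)
open import Data.Fin.Properties using (any?; +↔⊎)
open import Data.List using (List; []; _∷_; _++_; length; map; filter; allFin)
open import Data.List.Membership.Propositional using (_∈_; lose)
open import Data.List.Membership.Propositional.Properties using (∈-allFin; ∈-map⁺)
open import Data.List.NonEmpty as List⁺ using (List⁺; toList; _⁺++⁺_; _∷_; _∷⁺_)
open import Data.List.NonEmpty.Properties using (length-⁺++⁺; ⁺++⁺-assoc)
open import Data.List.Properties using (filter-accept; filter-reject)
open import Data.List.Relation.Unary.All as All using ()
open import Data.List.Relation.Unary.Any as Any using (Any; here; there)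
open import Data.Nat using (ℕ; zero; suc; _+_; _*_; _^_; _≤_; _<_; z≤n; s≤s; _≤?_; _<?_)
open import Data.Nat.Properties as ℕ using (anyUpTo?)
open import Data.Product using (∃; ∃₂; ∃-syntax; Σ; Σ-syntax; _×_; _,_; proj₁; proj₂) renaming (map to map×)
open import Data.Product.Function.Dependent.Propositional using () renaming (cong to Σ-cong)
open import Data.Sum using (_⊎_; inj₁; inj₂) renaming (map to map⊎)
open import Data.Sum.Function.Propositional using (_⊎-↔_)
open import Data.Unit using (⊤; tt)
open import Function using (_∘_; _↔_; Inverse; mk↔ₛ′; mk⇔; Equivalence)
open import Function.Construct.Composition using (_↔-∘_; _⇔-∘_)
open import Function.Construct.Identity using (↔-id)
open import Function.Construct.Symmetry using (↔-sym)
open import Level using (0ℓ)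
open import Relation.Binary using (IsPartialOrder; DecidableEquality)
import Relation.Binary as Binary
import Relation.Binary.Construct.Add.Supremum.Strict as StrictSup
open import Relation.Binary.PropositionalEquality
  using (_≡_; refl; sym; trans; cong; cong₂; subst; isEquivalence; module ≡-Reasoning)
open import Relation.Nullary
  using (¬_; Dec; yes; no; does; ¬?; _×-dec_; _⊎-dec_; _→-dec_; Irrelevant)
open import Relation.Nullary.Construct.Add.Supremum using (⊤⁺; [_])
open import Relation.Nullary.Decidable using (map′; from-yes; dec-true; dec-false; decidable-stable)
open import Relation.Unary using (Pred; Decidable)

-- Finite types and bounded searches

-- Words are read from the right because the truth of a formula on `a ∷ z` depends only on truth
-- values on `z` and on those of its operands on `a ∷ z`. The estimate from above is the one that
-- needs trees of bounded height: an idempotent node may multiply the error by `n`, so the error is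
-- a function of `n` alone only if the height is uniform in the word and in `n`. Stabilization nodes
-- have unbounded arity, so they must cost a constant factor; they do, because a counter that `e ♯`
-- still declares small is only reset or left alone by further copies of `e`. Uniform height is
-- delicate because a node with many children of value `e` has value `e ♯`, so the values in a tree
-- deviate from the products of its leaves. In an aperiodic monoid `e ♯` is either `e` or generates
-- a smaller ideal, so each deviation is progress for the induction. Updates are monotone tables
-- because the laws of `♯` compare the state after `e` with the smaller state after `e ♯`.

Finite-Dec : {P : Set} → Dec P → Irrelevant P → Finite P
Finite-Dec (yes p) irr = 1 , mk↔ₛ′ (λ _ → zero) (λ _ → p) (λ { zero → refl }) (λ q → irr p q)
Finite-Dec (no ¬p) _   = 0 , mk↔ₛ′ (⊥-elim ∘ ¬p) (λ ()) (λ ()) (⊥-elim ∘ ¬p)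

Finite-Σ : {X : Set} {P : X → Set} → Finite X → (∀ x → Finite (P x)) → Finite (Σ X P)
Finite-Σ {P = P} (m , X↔Fin) fin with Finite-ΣFin m (λ i → fin (Inverse.from X↔Fin i))
  where
  Finite-ΣFin : ∀ m {Q : Fin m → Set} → (∀ i → Finite (Q i)) → Finite (Σ (Fin m) Q)
  Finite-ΣFin zero    fin = 0 , mk↔ₛ′ (λ ()) (λ ()) (λ ()) (λ ())
  Finite-ΣFin (suc m) {Q} fin with fin zero | Finite-ΣFin m (fin ∘ suc)
  ... | k , f | l , g = k + l , ↔-sym +↔⊎ ↔-∘ ((f ⊎-↔ g) ↔-∘ split)
    where
    split : Σ (Fin (suc m)) Q ↔ (Q zero ⊎ Σ (Fin m) (Q ∘ suc))
    split = mk↔ₛ′ (λ { (zero , q) → inj₁ q ; (suc i , q) → inj₂ (i , q) })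
      (λ { (inj₁ q) → zero , q ; (inj₂ (i , q)) → suc i , q })
      (λ { (inj₁ q) → refl ; (inj₂ (i , q)) → refl })
      (λ { (zero , q) → refl ; (suc i , q) → refl })
... | k , f = k , f ↔-∘ ↔-sym (Σ-cong (↔-sym X↔Fin) (↔-id _))

module _ {X : Set} (finite : Finite X) where
  open Inverse (proj₂ finite)

  ∃? : {P : Pred X 0ℓ} → Decidable P → Dec (∃ P)
  ∃? {P} P? = map′ (λ (i , p) → from i , p)
    (λ (x , p) → to x , subst P (sym (strictlyInverseʳ x)) p) (any? (P? ∘ from))

  elements : List X
  elements = map from (allFin (proj₁ finite))

  ∈-elements : ∀ x → x ∈ elements
  ∈-elements x = subst (_∈ elements) (strictlyInverseʳ x) (∈-map⁺ from (∈-allFin (to x)))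

module _ {X : Set} {P Q : Pred X 0ℓ} (P? : Decidable P) (Q? : Decidable Q) (P⊆Q : ∀ {x} → P x → Q x) where

  count-mono : ∀ xs → length (filter P? xs) ≤ length (filter Q? xs)
  count-mono []       = z≤n
  count-mono (x ∷ xs) with P? x | Q? x
  ... | yes p | yes q = s≤s (count-mono xs)
  ... | yes p | no ¬q = ⊥-elim (¬q (P⊆Q p))
  ... | no ¬p | yes q = ℕ.m≤n⇒m≤1+n (count-mono xs)
  ... | no ¬p | no ¬q = count-mono xs

  -- An element of `Q` outside `P` would make the count for `Q` strictly larger.
  count-strict : ∀ {xs} → length (filter Q? xs) ≤ length (filter P? xs) →
                 ∀ {x} → x ∈ xs → Q x → P x
  count-strict {x ∷ xs} le x∈ q with P? x | Q? x
  count-strict {x ∷ xs} le (here refl) q  | yes p | _ = p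
  count-strict {x ∷ xs} le (here refl) q  | no ¬p | yes _ = ⊥-elim (ℕ.<⇒≱ le (count-mono xs))
  count-strict {x ∷ xs} le (here refl) q  | no ¬p | no ¬q = ⊥-elim (¬q q)
  count-strict {x ∷ xs} le (there x∈) q   | yes p | yes _ = count-strict (ℕ.≤-pred le) x∈ q
  count-strict {x ∷ xs} le (there x∈) q   | yes p | no ¬q = ⊥-elim (¬q (P⊆Q p))
  count-strict {x ∷ xs} le (there x∈) q   | no ¬p | yes _ = ⊥-elim (ℕ.<⇒≱ le (count-mono xs))
  count-strict {x ∷ xs} le (there x∈) q   | no ¬p | no _ = count-strict le x∈ q

module _ {X : Set} {_⊑_ : X → X → Set} (isPartialOrder : IsPartialOrder _≡_ _⊑_)
         (_⊑?_ : Binary.Decidable _⊑_) where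
  private module ⊑ = IsPartialOrder isPartialOrder

  minimalBelow : {P : Pred X 0ℓ} → Decidable P → ∀ xs {x} → P x →
    ∃[ y ] P y × y ⊑ x × (∀ {z} → z ∈ xs → P z → z ⊑ y → z ≡ y)
  minimalBelow P? []       {x} p = x , p , ⊑.refl , λ ()
  minimalBelow P? (w ∷ xs) {x} p with P? w ×-dec (w ⊑? x)
  ... | yes (pw , w⊑x) = let y , py , y⊑w , min = minimalBelow P? xs pw in
    y , py , ⊑.trans y⊑w w⊑x ,
    λ { (here refl) _ z⊑y → ⊑.antisym z⊑y y⊑w ; (there z∈) → min z∈ }
  ... | no ¬w = let y , py , y⊑x , min = minimalBelow P? xs p in
    y , py , y⊑x ,
    λ { (here refl) pz z⊑y → ⊥-elim (¬w (pz , ⊑.trans z⊑y y⊑x)) ; (there z∈) → min z∈ }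

splitting⁺? : {X : Set} {P : List⁺ X → List⁺ X → Set} → (∀ v w → Dec (P v w)) →
              ∀ u → Dec (∃₂ λ v w → u ≡ v ⁺++⁺ w × P v w)
splitting⁺? {X = B} P? (x ∷ xs) = split x xs P?
  where
  split : ∀ x xs {P : List⁺ B → List⁺ B → Set} → (∀ v w → Dec (P v w)) →
          Dec (∃₂ λ v w → x ∷ xs ≡ v ⁺++⁺ w × P v w)
  split x []       P? = no λ { (_ ∷ [] , _ , () , _) ; (_ ∷ _ ∷ _ , _ , () , _) }
  split x (y ∷ ys) P? = map′
    (λ { (inj₁ p) → _ , _ , refl , p
       ; (inj₂ (v , w , eq , p)) → x ∷⁺ v , w , cong (x ∷⁺_) eq , p })
    (λ { (_ ∷ [] , _ , refl , p) → inj₁ p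
       ; (_ ∷ z ∷ zs , w , refl , p) → inj₂ (z ∷ zs , w , refl , p) })
    (P? (x ∷ []) (y ∷ ys) ⊎-dec split y ys (λ v w → P? (x ∷⁺ v) w))

-- Decidability of trees of bounded height, and existence of valuations.

module Trees (S : StabilizationSemigroup) where
  open StabilizationSemigroup S
  open IsPartialOrder isPartialOrder using (antisym) renaming (refl to ≤ˢ-refl)

  _≟_ : DecidableEquality Carrier
  _≟_ = finite⇒≟ finite

  idem? : ∀ e → Dec (IsIdem e)
  idem? e = (e ∙ e) ≟ e

  -- Monotonicity of `♯` applied to `e ≤ e` in both directions. It lets a search settle on one proof
  -- of idempotence.
  ♯-unique : ∀ {e} (i j : IsIdem e) → e ♯[ i ] ≡ e ♯[ j ]
  ♯-unique i j = antisym (♯-mono i j ≤ˢ-refl) (♯-mono j i ≤ˢ-refl)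

  TreeWithin : ℕ → ℕ → List⁺ Carrier → Carrier → Set
  TreeWithin n h u s = Σ[ t ∈ Tree n u s ] height t ≤ h

  ForestWithin : ℕ → ℕ → Carrier → ℕ → List⁺ Carrier → Set
  ForestWithin n h e k u = Σ[ ts ∈ Forest n e k u ] heightᶠ ts ≤ h

  module _ {n : ℕ} where

    forest-length : ∀ {e k u} → Forest n e k u → k ≤ List⁺.length u
    forest-length (one t) = s≤s z≤n
    forest-length (_∷_ {u} {v} t ts) = ℕ.≤-trans
      (ℕ.+-mono-≤ (s≤s z≤n) (forest-length ts)) (ℕ.≤-reflexive (sym (length-⁺++⁺ u v)))

    forestWithin? : ∀ {h} → (∀ u s → Dec (TreeWithin n h u s)) → ∀ e k u → Dec (ForestWithin n h e k u)
    forestWithin? tree? e zero    u = no λ ()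
    forestWithin? tree? e (suc zero) u = map′ (λ (t , l) → one t , l)
      (λ { (one t , l) → t , l ; (t ∷ () , _) }) (tree? u e)
    forestWithin? tree? e (suc k@(suc _)) u = map′
      (λ { (_ , _ , refl , (t , l) , (ts , m)) → t ∷ ts , ℕ.⊔-lub l m })
      (λ { (t ∷ ts , l) → _ , _ , refl , (t , ℕ.m⊔n≤o⇒m≤o _ _ l) , (ts , ℕ.m⊔n≤o⇒n≤o (height t) _ l) })
      (splitting⁺? (λ v w → tree? v e ×-dec forestWithin? tree? e k w) u)

    -- Needed to select a minimal value constructively. The search is finite since every child
    -- covers a leaf, which bounds the arity by the length of the word.
    treeWithin? : ∀ h u s → Dec (TreeWithin n h u s)
    treeWithin? zero u s = map′ (λ { refl → leaf s , z≤n }) (λ { (leaf _ , _) → refl }) (leaf? u)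
      where
      leaf? : ∀ u → Dec (u ≡ List⁺.[ s ])
      leaf? (x ∷ [])     = map′ (cong List⁺.[_]) (cong List⁺.head) (x ≟ s)
      leaf? (x ∷ _ ∷ _) = no λ ()
    treeWithin? (suc h) u s = map′ join split
      (treeWithin? h u s
      ⊎-dec splitting⁺? (λ v w → ∃? finite λ x → ∃? finite λ y →
              (x ∙ y) ≟ s ×-dec treeWithin? h v x ×-dec treeWithin? h w y) u
      ⊎-dec (idem? s ×-dec anyUpTo? (λ k → k ≤? n ×-dec forestWithin? (treeWithin? h) s k u) (suc (List⁺.length u)))
      ⊎-dec ∃? finite λ e → stab? e)
      where
      Stab : Carrier → Set
      Stab e = Σ[ i ∈ IsIdem e ] (e ♯[ i ] ≡ s ×
        ∃[ k ] (k < suc (List⁺.length u) × n < k × ForestWithin n h e k u))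

      stab? : ∀ e → Dec (Stab e)
      stab? e with idem? e
      ... | no ¬i = no (¬i ∘ proj₁)
      ... | yes i = map′ (i ,_) (λ (j , eq , f) → trans (♯-unique i j) eq , f)
        ((e ♯[ i ]) ≟ s ×-dec anyUpTo? (λ k → n <? k ×-dec forestWithin? (treeWithin? h) e k u) (suc (List⁺.length u)))

      Choices : Set
      Choices = TreeWithin n h u s
        ⊎ (∃₂ λ v w → u ≡ v ⁺++⁺ w × ∃₂ λ x y → x ∙ y ≡ s × TreeWithin n h v x × TreeWithin n h w y)
        ⊎ (IsIdem s × ∃[ k ] (k < suc (List⁺.length u) × k ≤ n × ForestWithin n h s k u))
        ⊎ ∃ Stab

      join : Choices → TreeWithin n (suc h) u s
      join (inj₁ (t , l)) = t , ℕ.m≤n⇒m≤1+n l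
      join (inj₂ (inj₁ (_ , _ , refl , _ , _ , refl , (t , l) , (t′ , l′)))) = binary t t′ , s≤s (ℕ.⊔-lub l l′)
      join (inj₂ (inj₂ (inj₁ (i , k , _ , k≤n , ts , l)))) = idempotent i k≤n ts , s≤s l
      join (inj₂ (inj₂ (inj₂ (e , i , refl , k , _ , n<k , ts , l)))) = stabilization i n<k ts , s≤s l

      split : TreeWithin n (suc h) u s → Choices
      split (leaf _ , _) = inj₁ (leaf _ , z≤n)
      split (binary t t′ , s≤s l) = inj₂ (inj₁ (_ , _ , refl , _ , _ , refl ,
        (t , ℕ.m⊔n≤o⇒m≤o _ _ l) , (t′ , ℕ.m⊔n≤o⇒n≤o (height t) _ l)))
      split (idempotent i k≤n ts , s≤s l) = inj₂ (inj₂ (inj₁ (i , _ , s≤s (forest-length ts) , k≤n , ts , l)))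
      split (stabilization i n<k ts , s≤s l) =
        inj₂ (inj₂ (inj₂ (_ , i , refl , _ , s≤s (forest-length ts) , n<k , ts , l)))

  module _ (_≤ˢ?_ : Binary.Decidable _≤ˢ_) where

    valuation : ∀ H → (∀ u n → ∃[ s ] TreeWithin n H u s) → Σ[ ρ ∈ _ ] IsValuation H ρ
    valuation H exists = (λ u n → proj₁ (minimal u n)) , record
      { attained = λ u n → proj₁ (proj₂ (minimal u n))
      ; minimal  = λ u n t l → proj₂ (proj₂ (proj₂ (minimal u n))) (∈-elements finite _) (t , l)
      }
      where
      minimal : ∀ u n → _
      minimal u n = minimalBelow isPartialOrder _≤ˢ?_ (treeWithin? H u) (elements finite) (proj₂ (exists u n))

-- Factorization forests for aperiodic stabilization monoids

module Factorization (S : StabilizationSemigroup) {ε : StabilizationSemigroup.Carrier S}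
  (identity : Identity _≡_ ε (StabilizationSemigroup._∙_ S))
  (aperiodic : StabilizationSemigroup.Aperiodic S) where

  open StabilizationSemigroup S
  open IsSemigroup isSemigroup using (assoc)
  open Trees S
  open ≡-Reasoning

  private
    K : ℕ
    K = proj₁ aperiodic

  -- Powers, Green's relations and principal ideals in an aperiodic monoid.

  ^1+-+ : ∀ s i j → (s ^1+ i) ∙ (s ^1+ j) ≡ s ^1+ (i + suc j)
  ^1+-+ s zero    j = refl
  ^1+-+ s (suc i) j = trans (assoc _ _ _) (cong (s ∙_) (^1+-+ s i j))

  ^1+-stable : ∀ s j → s ^1+ (j + K) ≡ s ^1+ K
  ^1+-stable s zero    = refl
  ^1+-stable s (suc j) = trans (cong (s ∙_) (^1+-stable s j)) (proj₂ aperiodic s)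

  ^1+K-idem : ∀ s → IsIdem (s ^1+ K)
  ^1+K-idem s = begin
    (s ^1+ K) ∙ (s ^1+ K) ≡⟨ ^1+-+ s K K ⟩
    s ^1+ (K + suc K)     ≡⟨ cong (s ^1+_) (ℕ.+-comm K (suc K)) ⟩
    s ^1+ (suc K + K)     ≡⟨ ^1+-stable s (suc K) ⟩
    s ^1+ K               ∎

  ^1+-fixʳ : ∀ {x y} → x ∙ y ≡ x → ∀ j → x ∙ (y ^1+ j) ≡ x
  ^1+-fixʳ xy≡x zero    = xy≡x
  ^1+-fixʳ xy≡x (suc j) = trans (sym (assoc _ _ _)) (trans (cong (_∙ _) xy≡x) (^1+-fixʳ xy≡x j))

  ^1+-factor : ∀ x y j → ∃[ z ] (x ∙ y) ^1+ j ≡ x ∙ z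
  ^1+-factor x y zero    = y , refl
  ^1+-factor x y (suc j) = _ , assoc x y _

  sandwich : ∀ {x p y} → p ∙ x ∙ y ≡ x → ∀ j → ∃[ z ] (p ^1+ j) ∙ x ∙ z ≡ x
  sandwich {x} {p} {y} eq zero    = y , eq
  sandwich {x} {p} {y} eq (suc j) with sandwich {x} {p} {y} eq j
  ... | z , eq′ = z ∙ y , (begin
    p ∙ (p ^1+ j) ∙ x ∙ (z ∙ y)   ≡⟨ cong (_∙ (z ∙ y)) (assoc p _ x) ⟩
    p ∙ ((p ^1+ j) ∙ x) ∙ (z ∙ y) ≡⟨ assoc _ z y ⟨
    p ∙ ((p ^1+ j) ∙ x) ∙ z ∙ y   ≡⟨ cong (_∙ y) (trans (assoc p _ z) (cong (p ∙_) eq′)) ⟩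
    p ∙ x ∙ y                     ≡⟨ eq ⟩
    x                             ∎)

  -- Iterating the hypothesis puts a high power of `p` in front of `x`, and one more factor `p` does
  -- not change a stable power. In a general finite monoid `p ∙ x` would only be L-equivalent to
  -- `x`.
  absorbˡ : ∀ {x p y} → p ∙ x ∙ y ≡ x → p ∙ x ≡ x
  absorbˡ {x} {p} eq with sandwich eq K
  ... | z , eq′ = begin
    p ∙ x                     ≡⟨ cong (p ∙_) eq′ ⟨
    p ∙ ((p ^1+ K) ∙ x ∙ z)   ≡⟨ assoc p _ z ⟨
    p ∙ ((p ^1+ K) ∙ x) ∙ z   ≡⟨ cong (_∙ z) (assoc p _ x) ⟨
    p ∙ (p ^1+ K) ∙ x ∙ z     ≡⟨ cong (λ q → q ∙ x ∙ z) (proj₂ aperiodic p) ⟩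
    (p ^1+ K) ∙ x ∙ z         ≡⟨ eq′ ⟩
    x                         ∎

  absorbʳ : ∀ {x p y} → p ∙ x ∙ y ≡ x → x ∙ y ≡ x
  absorbʳ eq = trans (cong (_∙ _) (sym (absorbˡ eq))) eq

  -- Triviality of H-classes: `w` is a left multiple of `e` and `e` a right multiple of `w`, so in a
  -- finite monoid they are H-equivalent.
  collapse : ∀ {w e z} → w ∙ e ≡ w → w ∙ z ≡ e → w ≡ e
  collapse we≡w wz≡e = trans (sym we≡w) (absorbˡ (trans (cong (_∙ _) we≡w) wz≡e))

  _∈⟨_⟩ : Carrier → Carrier → Set
  z ∈⟨ x ⟩ = ∃₂ λ a b → a ∙ x ∙ b ≡ z

  _∈⟨_⟩? : ∀ z x → Dec (z ∈⟨ x ⟩)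
  z ∈⟨ x ⟩? = ∃? finite λ a → ∃? finite λ b → (a ∙ x ∙ b) ≟ z

  ∈⟨⟩-refl : ∀ {x} → x ∈⟨ x ⟩
  ∈⟨⟩-refl {x} = ε , ε , trans (proj₂ identity _) (proj₁ identity x)

  ∈⟨∙⟩⇒ʳ : ∀ {x y z} → z ∈⟨ x ∙ y ⟩ → z ∈⟨ x ⟩
  ∈⟨∙⟩⇒ʳ (a , b , eq) = a , _ ∙ b , trans (trans (sym (assoc _ _ b)) (cong (_∙ b) (assoc a _ _))) eq

  ∈⟨∙⟩⇒ˡ : ∀ {x y z} → z ∈⟨ x ∙ y ⟩ → z ∈⟨ y ⟩
  ∈⟨∙⟩⇒ˡ (a , b , eq) = a ∙ _ , b , trans (cong (_∙ b) (assoc a _ _)) eq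

  abstract
    rank : Carrier → ℕ
    rank x = length (filter _∈⟨ x ⟩? (elements finite))

    rank-∙ʳ : ∀ x y → rank (x ∙ y) ≤ rank x
    rank-∙ʳ x y = count-mono _∈⟨ x ∙ y ⟩? _∈⟨ x ⟩? ∈⟨∙⟩⇒ʳ (elements finite)

    rank-∙ˡ : ∀ x y → rank (x ∙ y) ≤ rank y
    rank-∙ˡ x y = count-mono _∈⟨ x ∙ y ⟩? _∈⟨ y ⟩? ∈⟨∙⟩⇒ˡ (elements finite)

    -- The ideal of `x ∙ y` is contained in that of `x`; if it is as large, then `x = a ∙ x ∙ y ∙ b`
    -- for some `a` and `b`, and `absorbʳ` removes `a`. In Green's terms, `x ∙ y` stays in the
    -- R-class of `x` unless it leaves the J-class.
    rank-cancelʳ : ∀ {x y} → rank x ≤ rank (x ∙ y) → ∃[ z ] x ∙ y ∙ z ≡ x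
    rank-cancelʳ {x} {y} le with count-strict _∈⟨ x ∙ y ⟩? _∈⟨ x ⟩? ∈⟨∙⟩⇒ʳ le (∈-elements finite x) ∈⟨⟩-refl
    ... | a , b , eq = b , trans (assoc x y b) (absorbʳ
      (trans (sym (assoc _ y b)) (trans (cong (_∙ b) (assoc a x y)) eq)))

  ♯-sandwich : ∀ {e} (i : IsIdem e) → e ♯[ i ] ≡ e ∙ e ♯[ i ] ∙ e
  ♯-sandwich {e} i = square i (sym i)
    where
    -- This is `♯-conj` with both factors equal to `e`; the product `e ∙ e` is renamed `f` so that
    -- one proof of idempotence serves on both sides.
    square : ∀ {f} (j : IsIdem f) → f ≡ e ∙ e → f ♯[ j ] ≡ e ∙ f ♯[ j ] ∙ e
    square j refl = ♯-conj j j

  ♯-absorbˡ : ∀ {e} (i : IsIdem e) → e ∙ e ♯[ i ] ≡ e ♯[ i ]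
  ♯-absorbˡ {e} i = begin
    e ∙ e ♯[ i ]               ≡⟨ cong (e ∙_) (♯-sandwich i) ⟩
    e ∙ (e ∙ e ♯[ i ] ∙ e)     ≡⟨ assoc e _ e ⟨
    e ∙ (e ∙ e ♯[ i ]) ∙ e     ≡⟨ cong (_∙ e) (trans (sym (assoc e e _)) (cong (_∙ e ♯[ i ]) i)) ⟩
    e ∙ e ♯[ i ] ∙ e           ≡⟨ ♯-sandwich i ⟨
    e ♯[ i ]                   ∎

  ♯-absorbʳ : ∀ {e} (i : IsIdem e) → e ♯[ i ] ∙ e ≡ e ♯[ i ]
  ♯-absorbʳ {e} i = begin
    e ♯[ i ] ∙ e               ≡⟨ cong (_∙ e) (♯-sandwich i) ⟩
    e ∙ e ♯[ i ] ∙ e ∙ e       ≡⟨ assoc _ e e ⟩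
    e ∙ e ♯[ i ] ∙ (e ∙ e)     ≡⟨ cong (e ∙ e ♯[ i ] ∙_) i ⟩
    e ∙ e ♯[ i ] ∙ e           ≡⟨ ♯-sandwich i ⟨
    e ♯[ i ]                   ∎

  -- If the rank does not fall, `e` is a right multiple of `e ♯[ i ]`; since
  -- `e ♯[ i ] ∙ e = e ♯[ i ]`, `collapse` identifies the two.
  ♯-same⊎drop : ∀ {e d} (i : IsIdem e) → rank e ≤ d → e ♯[ i ] ≡ e ⊎ rank (e ♯[ i ]) < d
  ♯-same⊎drop {e} i e≤d with ℕ.<-≤-connex (rank (e ♯[ i ])) (rank e)
  ... | inj₁ lt = inj₂ (ℕ.<-≤-trans lt e≤d)
  ... | inj₂ ge with rank-cancelʳ (ℕ.≤-trans ge (ℕ.≤-reflexive (cong rank (sym (♯-absorbˡ i)))))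
  ...   | z , eq = inj₁ (collapse (♯-absorbʳ i) (trans (cong (_∙ z) (sym (♯-absorbˡ i))) eq))

  -- The rank condition places `e` in the R-class of `p`, so that `e` is also a right multiple of
  -- `p`.
  Linking : Carrier → Carrier → Carrier → Set
  Linking s p e = IsIdem e × s ∙ e ≡ s × e ∙ p ≡ p × rank e ≤ rank p

  -- A form of the Clifford-Miller theorem. Some `z` satisfies `s ∙ p ∙ z = s`; the stable power of
  -- `p ∙ z` is idempotent, fixes `s` and is a right multiple of `p`. Its rank is at least that of
  -- `s`, hence that of `p`, so it lies in the R-class of `p`.
  linking : ∀ {s p} → rank s ≤ rank (s ∙ p) → rank p ≤ rank (s ∙ p) → ∃ (Linking s p)
  linking {s} {p} s≤ p≤ with rank-cancelʳ s≤
  ... | z , spz≡s with ^1+-factor p z K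
  ...   | t , e≡pt = e , ^1+K-idem (p ∙ z) , se≡s , ep≡p , ℕ.≤-trans (ℕ.≤-reflexive (cong rank e≡pt)) (rank-∙ʳ p t)
    where
    e : Carrier
    e = (p ∙ z) ^1+ K
    se≡s : s ∙ e ≡ s
    se≡s = ^1+-fixʳ (trans (sym (assoc s p z)) spz≡s) K
    p≤e : rank p ≤ rank (p ∙ t)
    p≤e = ℕ.≤-trans p≤ (ℕ.≤-trans (rank-∙ʳ s p) (ℕ.≤-trans (ℕ.≤-reflexive (cong rank (sym se≡s)))
      (ℕ.≤-trans (rank-∙ˡ s e) (ℕ.≤-reflexive (cong rank e≡pt)))))
    ep≡p : e ∙ p ≡ p
    ep≡p with rank-cancelʳ p≤e
    ... | x , ptx≡p = begin
      e ∙ p             ≡⟨ cong (e ∙_) p≡ex ⟩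
      e ∙ (e ∙ x)       ≡⟨ assoc e e x ⟨
      e ∙ e ∙ x         ≡⟨ cong (_∙ x) (^1+K-idem (p ∙ z)) ⟩
      e ∙ x             ≡⟨ p≡ex ⟨
      p                 ∎
      where
      p≡ex : p ≡ e ∙ x
      p≡ex = trans (sym ptx≡p) (cong (_∙ x) (sym e≡pt))

  -- Here `f` bounds the height of a fold at smaller rank. The inner 2 closes a run of equal values
  -- and joins a low block to it. Of the outer 3, one joins a leading run to the folded rest, and
  -- two join the parts before, between and after the cuts. The two successors in `foldHeight`
  -- likewise join a low item to a chain and a leading chain to the rest.
  chainHeight : (ℕ → ℕ) → List Carrier → ℕ → ℕ
  chainHeight f []      h = h
  chainHeight f (_ ∷ E) h = 3 + f (2 + chainHeight f E h)

  foldHeight : ℕ → ℕ → ℕ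
  foldHeight zero    h = h
  foldHeight (suc d) h = suc (foldHeight d (suc (chainHeight (foldHeight d) (elements finite) h)))

  chainHeight-inflationary : ∀ {f} → (∀ h → h ≤ f h) → ∀ E h → h ≤ chainHeight f E h
  chainHeight-inflationary infl []      h = ℕ.≤-refl
  chainHeight-inflationary infl (_ ∷ E) h = ℕ.≤-trans (chainHeight-inflationary infl E h)
    (ℕ.≤-trans (ℕ.m≤n+m _ 2) (ℕ.≤-trans (infl _) (ℕ.m≤n+m _ 3)))

  foldHeight-inflationary : ∀ d h → h ≤ foldHeight d h
  foldHeight-inflationary zero    h = ℕ.≤-refl
  foldHeight-inflationary (suc d) h = ℕ.≤-trans
    (chainHeight-inflationary (foldHeight-inflationary d) (elements finite) h)
    (ℕ.m≤n⇒m≤1+n (ℕ.≤-trans (ℕ.n≤1+n _) (foldHeight-inflationary d _)))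

  module _ {n : ℕ} where

    weaken : ∀ {h h′ u s} → h ≤ h′ → TreeWithin n h u s → TreeWithin n h′ u s
    weaken h≤h′ (t , l) = t , ℕ.≤-trans l h≤h′

    join : ∀ {h u v s t} → TreeWithin n h u s → TreeWithin n h v t → TreeWithin n (suc h) (u ⁺++⁺ v) (s ∙ t)
    join (t , l) (t′ , l′) = binary t t′ , s≤s (ℕ.⊔-lub l l′)

    Low : ℕ → ℕ → List⁺ Carrier → Set
    Low d h u = ∃[ s ] rank s < d × TreeWithin n h u s

    low-∙ˡ : ∀ {d h u v s} → Low d h u → TreeWithin n h v s → Low d (suc h) (u ⁺++⁺ v)
    low-∙ˡ (s , lt , t) t′ = _ , ℕ.≤-<-trans (rank-∙ʳ s _) lt , join t t′

    low-∙ʳ : ∀ {d h u v s} → TreeWithin n h u s → Low d h v → Low d (suc h) (u ⁺++⁺ v)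
    low-∙ʳ t (s , lt , t′) = _ , ℕ.≤-<-trans (rank-∙ˡ _ s) lt , join t t′

    low-weaken : ∀ {d h h′ u} → h ≤ h′ → Low d h u → Low d h′ u
    low-weaken h≤h′ (s , lt , t) = s , lt , weaken h≤h′ t

    data Blocks (G : List⁺ Carrier → Set) : List⁺ Carrier → Set where
      [_] : ∀ {u} → G u → Blocks G u
      _∷_ : ∀ {u v} → G u → Blocks G v → Blocks G (u ⁺++⁺ v)

    mapBlocks : ∀ {G G′ : List⁺ Carrier → Set} → (∀ {u} → G u → G′ u) → ∀ {u} → Blocks G u → Blocks G′ u
    mapBlocks f [ g ]    = [ f g ]
    mapBlocks f (g ∷ gs) = f g ∷ mapBlocks f gs

    -- Reading from the right, maximal runs of Top items are gathered into a Run;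
    -- a Low item, or a failed extension, multiplies the whole run down to Low.
    module _ {d h h′ : ℕ} {Top Run : List⁺ Carrier → Set}
      (start  : ∀ {u} → Top u → Run u)
      (extend : ∀ {u v} → Top u → Run v → Run (u ⁺++⁺ v) ⊎ Low d (suc h) (u ⁺++⁺ v))
      (close  : ∀ {u} → Run u → ∃ (TreeWithin n h u))
      (fold   : ∀ {u} → Blocks (Low d (suc h)) u → Low d h′ u)
      (h<h′   : h ≤ h′)
      where

      private
        data Grouped : List⁺ Carrier → Set where
          run     : ∀ {u} → Run u → Grouped u
          low     : ∀ {u} → Blocks (Low d (suc h)) u → Grouped u
          run∷low : ∀ {u v} → Run u → Blocks (Low d (suc h)) v → Grouped (u ⁺++⁺ v)

        consLow : ∀ {u v} → Low d h u → Grouped v → Grouped (u ⁺++⁺ v)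
        consLow x (run r)  = low [ low-∙ˡ x (proj₂ (close r)) ]
        consLow x (low ls) = low (low-weaken (ℕ.n≤1+n h) x ∷ ls)
        consLow x (run∷low r ls) = subst Grouped (⁺++⁺-assoc _ _ _)
          (low (low-∙ˡ x (proj₂ (close r)) ∷ ls))

        consTop : ∀ {u v} → Top u → Grouped v → Grouped (u ⁺++⁺ v)
        consTop x (run r) with extend x r
        ... | inj₁ r′ = run r′
        ... | inj₂ l  = low [ l ]
        consTop x (low ls) = run∷low (start x) ls
        consTop x (run∷low r ls) with extend x r
        ... | inj₁ r′ = subst Grouped (⁺++⁺-assoc _ _ _) (run∷low r′ ls)
        ... | inj₂ l  = subst Grouped (⁺++⁺-assoc _ _ _) (low (l ∷ ls))

        grouped : ∀ {u} → Blocks (λ w → Low d h w ⊎ Top w) u → Grouped u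
        grouped [ inj₁ l ]    = low [ low-weaken (ℕ.n≤1+n h) l ]
        grouped [ inj₂ x ]    = run (start x)
        grouped (inj₁ l ∷ xs) = consLow l (grouped xs)
        grouped (inj₂ x ∷ xs) = consTop x (grouped xs)

      group : ∀ {u} → Blocks (λ w → Low d h w ⊎ Top w) u → Run u ⊎ Low d (suc h′) u
      group xs with grouped xs
      ... | run r        = inj₁ r
      ... | low ls       = inj₂ (low-weaken (ℕ.n≤1+n h′) (fold ls))
      ... | run∷low r ls = inj₂ (low-∙ʳ (weaken h<h′ (proj₂ (close r))) (fold ls))

    module _ {d : ℕ} where

      -- A tree may miss the intended product `p` because of stabilization, but then its rank has
      -- fallen, and no further multiplication can raise it again.
      Approx : ℕ → Carrier → List⁺ Carrier → Set
      Approx h p u = ∃[ s ] (s ≡ p ⊎ rank s < d) × TreeWithin n h u s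

      approx-∙ : ∀ {h u v p q} → Approx h p u → Approx h q v → Approx (suc h) (p ∙ q) (u ⁺++⁺ v)
      approx-∙ (_ , inj₁ refl , t) (_ , inj₁ refl , t′) = _ , inj₁ refl , join t t′
      approx-∙ (s , inj₂ lt , t) (_ , _ , t′) = _ , inj₂ (ℕ.≤-<-trans (rank-∙ʳ s _) lt) , join t t′
      approx-∙ (s , inj₁ _ , t) (s′ , inj₂ lt , t′) = _ , inj₂ (ℕ.≤-<-trans (rank-∙ˡ s s′) lt) , join t t′

      approx-weaken : ∀ {h h′ p u} → h ≤ h′ → Approx h p u → Approx h′ p u
      approx-weaken h≤h′ (s , a , t) = s , a , weaken h≤h′ t

      iterate : ∀ {h e k u} → IsIdem e → rank e ≤ d → ForestWithin n h e k u → Approx (suc h) e u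
      iterate {k = k} i e≤d (ts , l) with k ≤? n
      ... | yes k≤n = _ , inj₁ refl , idempotent i k≤n ts , s≤s l
      ... | no  k≰n = _ , ♯-same⊎drop i e≤d , stabilization i (ℕ.≰⇒> k≰n) ts , s≤s l

      -- All suffix products stay in rank `d`, and each junction has a linking idempotent in `E`.
      -- Keeping `E` as a parameter allows an induction on the idempotents still in use instead of
      -- on the length of the word.
      data Chain (h : ℕ) (E : List Carrier) : List⁺ Carrier → Carrier → Set where
        [_] : ∀ {u s} → rank s ≡ d × TreeWithin n h u s → Chain h E u s
        _∷⟨_,_⟩_ : ∀ {u v s p} → rank s ≡ d × TreeWithin n h u s → Any (Linking s p) E → rank (s ∙ p) ≡ d →
          Chain h E v p → Chain h E (u ⁺++⁺ v) (s ∙ p)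

      chain-rank : ∀ {h E u p} → Chain h E u p → rank p ≡ d
      chain-rank [ r , _ ]          = r
      chain-rank (_ ∷⟨ _ , r ⟩ _) = r

      rank-prefix : ∀ {p q} → rank p ≡ d → rank (p ∙ q) ≡ d → rank p ≤ rank (p ∙ q)
      rank-prefix p≡d pq≡d = ℕ.≤-reflexive (trans p≡d (sym pq≡d))

      -- Since `p` and `p ∙ q` are R-equivalent, they have the same left identities.
      linking-prefix : ∀ {s p q} → rank p ≡ d → rank (p ∙ q) ≡ d → ∀ {e} → Linking s (p ∙ q) e → Linking s p e
      linking-prefix {s} {p} {q} p≡d pq≡d {e} (i , se≡s , epq≡pq , e≤pq)
        with rank-cancelʳ (rank-prefix p≡d pq≡d)
      ... | z , pqz≡p = i , se≡s , ep≡p , ℕ.≤-trans e≤pq (rank-∙ʳ p q)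
        where
        ep≡p : e ∙ p ≡ p
        ep≡p = begin
          e ∙ p             ≡⟨ cong (e ∙_) pqz≡p ⟨
          e ∙ (p ∙ q ∙ z)   ≡⟨ assoc e _ z ⟨
          e ∙ (p ∙ q) ∙ z   ≡⟨ cong (_∙ z) epq≡pq ⟩
          p ∙ q ∙ z         ≡⟨ pqz≡p ⟩
          p                 ∎

      -- The link on the left makes `e` a right multiple of `p`, the hypothesis makes `p` a left
      -- multiple of `e`, and `collapse` applies.
      linked≡ : ∀ {s p e} → Linking s p e → p ∙ e ≡ p → p ≡ e
      linked≡ {p = p} {e} (_ , _ , ep≡p , e≤p) pe≡p with rank-cancelʳ (ℕ.≤-trans e≤p (ℕ.≤-reflexive (cong rank (sym ep≡p))))
      ... | z , epz≡e = collapse pe≡p (trans (cong (_∙ z) (sym ep≡p)) epz≡e)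

      module _ (f : ℕ → ℕ) (infl : ∀ h → h ≤ f h)
               (fold : ∀ {h u} → Blocks (Low d h) u → Low d (f h) u) where

        -- Between two consecutive links through e the product is e itself.
        data Cut (h h₁ : ℕ) (e : Carrier) (E : List Carrier) : List⁺ Carrier → Carrier → Set where
          uncut  : ∀ {u p} → Chain h E u p → Cut h h₁ e E u p
          once   : ∀ {u v p q} → Chain h E u p → p ∙ e ≡ p →
                   Approx h₁ q v → e ∙ q ≡ q → rank (p ∙ q) ≡ d → Cut h h₁ e E (u ⁺++⁺ v) (p ∙ q)
          often  : ∀ {u v w p q} → IsIdem e × rank e ≤ d → Chain h E u p → p ∙ e ≡ p → Blocks (Approx h₁ e) v →
                   Approx h₁ q w → e ∙ q ≡ q → rank (p ∙ q) ≡ d → Cut h h₁ e E (u ⁺++⁺ v ⁺++⁺ w) (p ∙ q)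

        module _ {h : ℕ} {e : Carrier} {E : List Carrier}
                 (evalE : ∀ {u p} → Chain h E u p → Approx (chainHeight f E h) p u) where
          private
            h₁ : ℕ
            h₁ = chainHeight f E h

          rank-middle : ∀ {s p q} → rank s ≡ d → rank (s ∙ (p ∙ q)) ≡ d → rank (s ∙ p) ≡ d
          rank-middle {s} {p} {q} s≡d spq≡d = ℕ.≤-antisym
            (ℕ.≤-trans (rank-∙ʳ s p) (ℕ.≤-reflexive s≡d))
            (ℕ.≤-trans (ℕ.≤-reflexive (trans (sym spq≡d) (cong rank (sym (assoc s p q))))) (rank-∙ʳ (s ∙ p) q))

          consCut : ∀ {u v s p} → rank s ≡ d × TreeWithin n h u s → Any (Linking s p) (e ∷ E) →
                    rank (s ∙ p) ≡ d → Cut h h₁ e E v p → Cut h h₁ e E (u ⁺++⁺ v) (s ∙ p)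
          consCut x (here (_ , se , ep , _)) r (uncut c) = once [ x ] se (evalE c) ep r
          -- The former first segment now lies between two links through `e`: it becomes a middle
          -- block of value `e`, and `q = p ∙ q` shows that the total product does not notice.
          consCut {s = s} x (here l) r (once {p = p} {q} c pe a eq r′) =
            subst (λ m → Cut _ _ _ _ _ (s ∙ m)) q≡pq
              (often (proj₁ l , ℕ.≤-trans (proj₂ (proj₂ (proj₂ l))) (ℕ.≤-reflexive r′)) [ x ] (proj₁ (proj₂ l))
                [ subst (λ m → Approx h₁ m _) p≡e (evalE c) ] a eq
                (trans (cong (λ m → rank (s ∙ m)) q≡pq) r))
            where
            p≡e : p ≡ e
            p≡e = linked≡ (linking-prefix (chain-rank c) r′ l) pe
            q≡pq : q ≡ p ∙ q
            q≡pq = trans (sym eq) (cong (_∙ q) (sym p≡e))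
          consCut {s = s} x (here l) r (often {p = p} {q} i c pe bs a eq r′) =
            subst (λ m → Cut _ _ _ _ _ (s ∙ m)) q≡pq
              (subst (λ w → Cut _ _ _ _ (_ ⁺++⁺ w) (s ∙ q)) (⁺++⁺-assoc _ _ _)
                (often i [ x ] (proj₁ (proj₂ l)) (subst (λ m → Approx h₁ m _) p≡e (evalE c) ∷ bs) a eq
                  (trans (cong (λ m → rank (s ∙ m)) q≡pq) r)))
            where
            p≡e : p ≡ e
            p≡e = linked≡ (linking-prefix (chain-rank c) r′ l) pe
            q≡pq : q ≡ p ∙ q
            q≡pq = trans (sym eq) (cong (_∙ q) (sym p≡e))
          consCut x (there g) r (uncut c) = uncut (x ∷⟨ g , r ⟩ c)
          -- Only the first segment grows. Its new link was found for the whole product `p ∙ q` and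
          -- has to be restricted to `p`.
          consCut {s = s} x (there g) r (once {p = p} {q} c pe a eq r′) =
            subst (λ w → Cut _ _ _ _ w _) (⁺++⁺-assoc _ _ _) (subst (Cut _ _ _ _ _) (assoc s p q)
              (once (x ∷⟨ Any.map (linking-prefix (chain-rank c) r′) g , rank-middle (proj₁ x) r ⟩ c)
                (trans (assoc s p e) (cong (s ∙_) pe)) a eq (trans (cong rank (assoc s p q)) r)))
          consCut {s = s} x (there g) r (often {p = p} {q} i c pe bs a eq r′) =
            subst (λ w → Cut _ _ _ _ w _) (⁺++⁺-assoc _ _ _) (subst (Cut _ _ _ _ _) (assoc s p q)
              (often i (x ∷⟨ Any.map (linking-prefix (chain-rank c) r′) g , rank-middle (proj₁ x) r ⟩ c)
                (trans (assoc s p e) (cong (s ∙_) pe)) bs a eq (trans (cong rank (assoc s p q)) r)))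

          cut : ∀ {u p} → Chain h (e ∷ E) u p → Cut h h₁ e E u p
          cut [ x ]              = uncut [ x ]
          cut (x ∷⟨ g , r ⟩ c) = consCut x g r (cut c)

          Run : List⁺ Carrier → Set
          Run u = ∃[ k ] ForestWithin n h₁ e k u

          -- All middle blocks aim at the same idempotent, so those that reach it can be children of
          -- a single node, whatever their number. This is where nodes of unbounded arity arise.
          evalMiddle : IsIdem e × rank e ≤ d → ∀ {u} → Blocks (Approx h₁ e) u → Approx (suc (f (2 + h₁))) e u
          evalMiddle (i , e≤d) bs with group {Top = λ u → TreeWithin n h₁ u e} {Run}
            (λ (t , l) → 1 , one t , l)
            (λ (t , l) (k , ts , l′) → inj₁ (suc k , t ∷ ts , ℕ.⊔-lub l l′))
            (λ (k , ts) → let s , _ , t = iterate i e≤d ts in s , t)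
            fold (ℕ.≤-trans (ℕ.n≤1+n _) (infl _)) (mapBlocks classify bs)
            where
            classify : ∀ {u} → Approx h₁ e u → Low d (suc h₁) u ⊎ TreeWithin n h₁ u e
            classify (_ , inj₁ refl , t) = inj₂ t
            classify (s , inj₂ lt , t)   = inj₁ (s , lt , weaken (ℕ.n≤1+n _) t)
          ... | inj₁ (k , ts) = approx-weaken (ℕ.≤-trans (ℕ.n≤1+n _) (ℕ.m≤n⇒m≤1+n (infl _))) (iterate i e≤d ts)
          ... | inj₂ (s , lt , t) = s , inj₂ lt , t

          evalCut : ∀ {u p} → Cut h h₁ e E u p → Approx (chainHeight f (e ∷ E) h) p u
          evalCut (uncut c) = approx-weaken h₁≤ (evalE c)
            where
            h₁≤ : h₁ ≤ 3 + f (2 + h₁)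
            h₁≤ = ℕ.≤-trans (ℕ.m≤n+m _ 2) (ℕ.≤-trans (infl _) (ℕ.m≤n+m _ 3))
          evalCut (once c pe a eq r) = approx-weaken (s≤s h₁≤) (approx-∙ (evalE c) a)
            where
            h₁≤ : h₁ ≤ 2 + f (2 + h₁)
            h₁≤ = ℕ.≤-trans (ℕ.m≤n+m _ 2) (ℕ.≤-trans (infl _) (ℕ.m≤n+m _ 2))
          evalCut (often {p = p} i c pe bs a eq r) =
            subst (λ m → Approx _ (p ∙ m) _) eq
              (approx-∙ (approx-weaken (ℕ.m≤n⇒m≤1+n h₁≤) (evalE c))
                (approx-∙ (evalMiddle i bs) (approx-weaken h₁≤ a)))
            where
            h₁≤ : h₁ ≤ 1 + f (2 + h₁)
            h₁≤ = ℕ.≤-trans (ℕ.m≤n+m _ 2) (ℕ.≤-trans (infl _) (ℕ.m≤n+m _ 1))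

        -- After cutting at the links through `e`, the segments are chains with links in the
        -- remaining list; with no link left, a chain is a single item. Hence the height depends on
        -- `E` and not on the length of the chain.
        evalChain : ∀ {h} E {u p} → Chain h E u p → Approx (chainHeight f E h) p u
        evalChain []      [ _ , t ]           = _ , inj₁ refl , t
        evalChain []      (_ ∷⟨ () , _ ⟩ _)
        evalChain (e ∷ E) c = evalCut {e = e} {E} (evalChain E) (cut (evalChain E) c)

        foldStep : ∀ {h u} → Blocks (Low (suc d) h) u →
                   Low (suc d) (suc (f (suc (chainHeight f (elements finite) h)))) u
        foldStep {h} bs with group {Top = λ u → ∃[ s ] rank s ≡ d × TreeWithin n h u s}
            {Run = λ u → ∃ (Chain h (elements finite) u)}
            (λ (s , x) → s , [ x ]) extend (λ (p , c) → let s , _ , t = evalChain _ c in s , t)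
            fold (ℕ.≤-trans (ℕ.n≤1+n _) (infl _)) (mapBlocks classify bs)
          where
          h≤ : h ≤ chainHeight f (elements finite) h
          h≤ = chainHeight-inflationary infl (elements finite) h

          classify : ∀ {u} → Low (suc d) h u →
            Low d (chainHeight f (elements finite) h) u ⊎ ∃[ s ] rank s ≡ d × TreeWithin n h u s
          classify (s , lt , t) with ℕ.m<1+n⇒m<n∨m≡n lt
          ... | inj₁ lt′ = inj₁ (s , lt′ , weaken h≤ t)
          ... | inj₂ eq  = inj₂ (s , eq , t)

          extend : ∀ {u v} → ∃[ s ] rank s ≡ d × TreeWithin n h u s → ∃ (Chain h (elements finite) v) →
            ∃ (Chain h (elements finite) (u ⁺++⁺ v)) ⊎ Low d (suc (chainHeight f (elements finite) h)) (u ⁺++⁺ v)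
          extend (s , s≡d , t) (p , c) with rank (s ∙ p) ℕ.≟ d
          ... | yes sp≡d =
            let e , l = linking (rank-prefix s≡d sp≡d) (ℕ.≤-reflexive (trans (chain-rank c) (sym sp≡d)))
            in inj₁ (_ , (s≡d , t) ∷⟨ lose (∈-elements finite e) l , sp≡d ⟩ c)
          -- As `s` has rank `d`, the product can only have fallen below `d`, so evaluating the
          -- chain and joining gives a low block.
          ... | no sp≢d with evalChain _ c
          ...   | _ , inj₁ refl , t′ = inj₂ (_ ,
            ℕ.≤∧≢⇒< (ℕ.≤-trans (rank-∙ʳ s p) (ℕ.≤-reflexive s≡d)) sp≢d , join (weaken h≤ t) t′)
          ...   | x , inj₂ lt , t′ = inj₂ (low-∙ʳ (weaken h≤ t) (x , lt , t′))
        ... | inj₂ (s , lt , t) = s , ℕ.m<n⇒m<1+n lt , t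
        ... | inj₁ (p , c) with evalChain _ c
        ...   | s , a , t = s , bound a , weaken (ℕ.≤-trans (ℕ.n≤1+n _) (ℕ.m≤n⇒m≤1+n (infl _))) t
          where
          bound : s ≡ p ⊎ rank s < d → rank s < suc d
          bound (inj₁ refl) = s≤s (ℕ.≤-reflexive (chain-rank c))
          bound (inj₂ lt)   = ℕ.m<n⇒m<1+n lt

    foldLow : ∀ d {h u} → Blocks (Low d h) u → Low d (foldHeight d h) u
    foldLow zero    [ _ , () , _ ]
    foldLow zero    ((_ , () , _) ∷ _)
    foldLow (suc d) bs = foldStep (foldHeight d) (foldHeight-inflationary d) (foldLow d) bs

  abstract
    factorization : ∃[ H ] (∀ u n → ∃ (TreeWithin n H u))
    factorization = foldHeight d 0 , λ { (x ∷ xs) n → let s , _ , t = foldLow d (leaves n x xs) in s , t }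
      where
      -- The ideal of `ε` is the whole monoid, so `rank ε` is the maximal rank and every single
      -- letter is low.
      d : ℕ
      d = suc (rank ε)

      letterBlock : ∀ n x → Low {n} d 0 List⁺.[ x ]
      letterBlock n x = x , s≤s (ℕ.≤-trans (ℕ.≤-reflexive (cong rank (sym (proj₁ identity x)))) (rank-∙ʳ ε x)) ,
        leaf x , z≤n

      leaves : ∀ n x xs → Blocks {n} (Low {n} d 0) (x ∷ xs)
      leaves n x []       = [ letterBlock n x ]
      leaves n x (y ∷ ys) = letterBlock n x ∷ leaves n y ys

-- The cascade

-- The effect of a word on a counter: it becomes larger than the threshold, is
-- increased, is left as it is, or is reset to a small value. In x · y the
-- action y is performed first.
data Action : Set where
  bot inc idle set : Action

infixl 7 _·_
_·_ : Action → Action → Action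
bot  · _   = bot
set  · _   = set
idle · x   = x
inc  · bot = bot
inc  · set = set
inc  · _   = inc

iter : Action → Action
iter inc = bot
iter x   = x

level : Action → ℕ
level bot  = 0
level inc  = 1
level idle = 2
level set  = 3

infix 4 _⊑_
-- The smaller the action, the worse for the counter. With this orientation the rejecting elements
-- are closed downward.
_⊑_ : Action → Action → Set
x ⊑ y = level x ≤ level y

level-injective : ∀ {x y} → level x ≡ level y → x ≡ y
level-injective {bot}  {bot}  _ = refl
level-injective {inc}  {inc}  _ = refl
level-injective {idle} {idle} _ = refl
level-injective {set}  {set}  _ = refl

⊑-reflexive : ∀ {x y} → x ≡ y → x ⊑ y
⊑-reflexive refl = ℕ.≤-refl

⊑-antisym : ∀ {x y} → x ⊑ y → y ⊑ x → x ≡ y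
⊑-antisym p q = level-injective (ℕ.≤-antisym p q)

_≟ᴬ_ : DecidableEquality Action
x ≟ᴬ y = map′ level-injective (cong level) (level x ℕ.≟ level y)

_⊑?_ : Binary.Decidable _⊑_
x ⊑? y = level x ℕ.≤? level y

all? : {P : Action → Set} → Decidable P → Dec (∀ x → P x)
all? P? = map′
  (λ { (b , i , d , s) → λ { bot → b ; inc → i ; idle → d ; set → s } })
  (λ f → f bot , f inc , f idle , f set)
  (P? bot ×-dec P? inc ×-dec P? idle ×-dec P? set)

Finite-Action : Finite Action
Finite-Action = 4 , mk↔ₛ′
  (λ { bot → zero ; inc → suc zero ; idle → suc (suc zero) ; set → suc (suc (suc zero)) })
  (λ { zero → bot ; (suc zero) → inc ; (suc (suc zero)) → idle ; (suc (suc (suc zero))) → set })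
  (λ { zero → refl ; (suc zero) → refl ; (suc (suc zero)) → refl ; (suc (suc (suc zero))) → refl })
  (λ { bot → refl ; inc → refl ; idle → refl ; set → refl })

·-assoc : ∀ x y z → x · y · z ≡ x · (y · z)
·-assoc = from-yes (all? λ x → all? λ y → all? λ z → (x · y · z) ≟ᴬ (x · (y · z)))

·-idem : ∀ x → x · x ≡ x
·-idem = from-yes (all? λ x → (x · x) ≟ᴬ x)

·-identityʳ : ∀ x → x · idle ≡ x
·-identityʳ = from-yes (all? λ x → (x · idle) ≟ᴬ x)

·-mono : ∀ {x y z w} → x ⊑ y → z ⊑ w → x · z ⊑ y · w
·-mono {x} {y} {z} {w} = from-yes (all? λ x → all? λ y → all? λ z → all? λ w →
  (x ⊑? y) →-dec (z ⊑? w) →-dec ((x · z) ⊑? (y · w))) x y z w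

iter-mono : ∀ {x y} → x ⊑ y → iter x ⊑ iter y
iter-mono {x} {y} = from-yes (all? λ x → all? λ y → (x ⊑? y) →-dec (iter x ⊑? iter y)) x y

iter-absorb : ∀ x z → iter x · x · (iter x · z) ≡ iter x · z
iter-absorb = from-yes (all? λ x → all? λ z → (iter x · x · (iter x · z)) ≟ᴬ (iter x · z))

iter-iter : ∀ x z → iter (iter x · x) · (iter x · z) ≡ iter x · z
iter-iter = from-yes (all? λ x → all? λ z → (iter (iter x · x) · (iter x · z)) ≟ᴬ (iter x · z))

iter-⊑ : ∀ {x y z} → x ⊑ y → y · z ≡ z → iter x · z ⊑ z
iter-⊑ {x} {y} {z} = from-yes (all? λ x → all? λ y → all? λ z →
  (x ⊑? y) →-dec ((y · z) ≟ᴬ z) →-dec ((iter x · z) ⊑? z)) x y z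

-- In the use for `♯-conj′`, `x` and `y` are the actions in the settled state, `x′` and `y′` those
-- after a single round; `♯-⊑` gives the inequalities and idempotence the equation.
iter-conj : ∀ {x x′ y y′ z} → x ⊑ x′ → y ⊑ y′ → x′ · (y′ · z) ≡ z →
            iter (x · y) · z ≡ x · (iter (y · x) · (y′ · z))
iter-conj {x} {x′} {y} {y′} {z} = from-yes (all? λ x → all? λ x′ → all? λ y → all? λ y′ → all? λ z →
  (x ⊑? x′) →-dec (y ⊑? y′) →-dec ((x′ · (y′ · z)) ≟ᴬ z) →-dec
  ((iter (x · y) · z) ≟ᴬ (x · (iter (y · x) · (y′ · z))))) x x′ y y′ z

·-iter : ∀ x → x · iter x ≡ iter x
·-iter = from-yes (all? λ x → (x · iter x) ≟ᴬ iter x)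

infixr 6 _▹_
_▹_ : Action → Bool → Bool
bot ▹ _ = false
set ▹ _ = true
_   ▹ b = b

·-▹ : ∀ x y b → (x · y) ▹ b ≡ x ▹ y ▹ b
·-▹ bot  y    b = refl
·-▹ inc  bot  b = refl
·-▹ inc  inc  b = refl
·-▹ inc  idle b = refl
·-▹ inc  set  b = refl
·-▹ idle y    b = refl
·-▹ set  y    b = refl

▹-mono : ∀ {x y b c} → x ⊑ y → (T b → T c) → T (x ▹ b) → T (y ▹ c)
▹-mono {inc}  {inc}  _ f t = f t
▹-mono {inc}  {idle} _ f t = f t
▹-mono {inc}  {set}  _ f t = tt
▹-mono {idle} {idle} _ f t = f t
▹-mono {idle} {set}  _ f t = tt
▹-mono {set}  {set}  _ f t = tt
▹-mono {idle} {inc} (s≤s ()) f t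
▹-mono {set} {inc} (s≤s ()) f t
▹-mono {set} {idle} (s≤s (s≤s ())) f t

-- States, monotone tables and their iterated wreath product.

State : ℕ → Set
State zero    = ⊤
State (suc k) = State k × Bool

infix 4 _≼_
_≼_ : ∀ {k} → State k → State k → Set
_≼_ {zero}  _       _         = ⊤
_≼_ {suc k} (q , b) (q′ , b′) = q ≼ q′ × (T b → T b′)

≼-refl : ∀ {k} {q : State k} → q ≼ q
≼-refl {zero}  = tt
≼-refl {suc k} = ≼-refl {k} , λ t → t

-- A tree of entries instead of a function on states, so that tables with the same entries are
-- propositionally equal and the type is finite.
Table : ℕ → Set
Table zero    = Action
Table (suc k) = Table k × Table k

lookup : ∀ {k} → Table k → State k → Action
lookup {zero}  x       _           = x
lookup {suc k} (f , g) (q , false) = lookup f q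
lookup {suc k} (f , g) (q , true)  = lookup g q

tabulate : ∀ {k} → (State k → Action) → Table k
tabulate {zero}  F = F tt
tabulate {suc k} F = tabulate (λ q → F (q , false)) , tabulate (λ q → F (q , true))

lookup-tabulate : ∀ {k} (F : State k → Action) q → lookup (tabulate F) q ≡ F q
lookup-tabulate {zero}  F _           = refl
lookup-tabulate {suc k} F (q , false) = lookup-tabulate (λ q → F (q , false)) q
lookup-tabulate {suc k} F (q , true)  = lookup-tabulate (λ q → F (q , true)) q

lookup-injective : ∀ {k} {f g : Table k} → (∀ q → lookup f q ≡ lookup g q) → f ≡ g
lookup-injective {zero}  eq = eq tt
lookup-injective {suc k} eq =
  cong₂ _,_ (lookup-injective (λ q → eq (q , false))) (lookup-injective (λ q → eq (q , true)))

Finite-Table : ∀ k → Finite (Table k)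
Finite-Table zero    = Finite-Action
Finite-Table (suc k) = Finite-Σ (Finite-Table k) (λ _ → Finite-Table k)

infix 4 _⊑ᵀ_
_⊑ᵀ_ : ∀ {k} → Table k → Table k → Set
_⊑ᵀ_ {zero}  x       y         = x ⊑ y
_⊑ᵀ_ {suc k} (f , g) (f′ , g′) = f ⊑ᵀ f′ × g ⊑ᵀ g′

_⊑ᵀ?_ : ∀ {k} → Binary.Decidable (_⊑ᵀ_ {k})
_⊑ᵀ?_ {zero}  x       y         = x ⊑? y
_⊑ᵀ?_ {suc k} (f , g) (f′ , g′) = (f ⊑ᵀ? f′) ×-dec (g ⊑ᵀ? g′)

⊑ᵀ-irrelevant : ∀ {k} {f g : Table k} → Irrelevant (f ⊑ᵀ g)
⊑ᵀ-irrelevant {zero}  p q = ℕ.≤-irrelevant p q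
⊑ᵀ-irrelevant {suc k} (p , q) (p′ , q′) = cong₂ _,_ (⊑ᵀ-irrelevant {k} p p′) (⊑ᵀ-irrelevant {k} q q′)

⊑ᵀ⇒lookup : ∀ {k} {f g : Table k} → f ⊑ᵀ g → ∀ q → lookup f q ⊑ lookup g q
⊑ᵀ⇒lookup {zero}  le       _           = le
⊑ᵀ⇒lookup {suc k} (le , _) (q , false) = ⊑ᵀ⇒lookup {k} le q
⊑ᵀ⇒lookup {suc k} (_ , le) (q , true)  = ⊑ᵀ⇒lookup {k} le q

lookup⇒⊑ᵀ : ∀ {k} {f g : Table k} → (∀ q → lookup f q ⊑ lookup g q) → f ⊑ᵀ g
lookup⇒⊑ᵀ {zero}  le = le tt
lookup⇒⊑ᵀ {suc k} le = lookup⇒⊑ᵀ {k} (λ q → le (q , false)) , lookup⇒⊑ᵀ {k} (λ q → le (q , true))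

Monotone : ∀ {k} → (State k → Action) → Set
Monotone F = ∀ {q q′} → q ≼ q′ → F q ⊑ F q′

-- Equivalent to `Monotone (lookup f)`, but decidable and with at most one proof; thus updates are
-- finite in number and determined by their entries.
MonotoneTable : ∀ {k} → Table k → Set
MonotoneTable {zero}  _       = ⊤
MonotoneTable {suc k} (f , g) = MonotoneTable f × MonotoneTable g × f ⊑ᵀ g

monotoneTable? : ∀ {k} (f : Table k) → Dec (MonotoneTable f)
monotoneTable? {zero}  _       = yes tt
monotoneTable? {suc k} (f , g) = monotoneTable? f ×-dec monotoneTable? g ×-dec (f ⊑ᵀ? g)

monotoneTable-irrelevant : ∀ {k} (f : Table k) → Irrelevant (MonotoneTable f)
monotoneTable-irrelevant {zero}  _       _ _ = refl
monotoneTable-irrelevant {suc k} (f , g) (p , q , r) (p′ , q′ , r′) =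
  cong₂ _,_ (monotoneTable-irrelevant f p p′)
    (cong₂ _,_ (monotoneTable-irrelevant g q q′) (⊑ᵀ-irrelevant {k} r r′))

monotoneTable⇒monotone : ∀ {k} {f : Table k} → MonotoneTable f → Monotone (lookup f)
monotoneTable⇒monotone {zero} _ _ = ℕ.≤-refl
monotoneTable⇒monotone {suc k} (p , q , r) {x , false} {x′ , false} (le , _) = monotoneTable⇒monotone {k} p le
monotoneTable⇒monotone {suc k} (p , q , r) {x , false} {x′ , true}  (le , _) =
  ℕ.≤-trans (monotoneTable⇒monotone {k} p le) (⊑ᵀ⇒lookup {k} r x′)
monotoneTable⇒monotone {suc k} (p , q , r) {x , true}  {x′ , false} (_ , f)  = ⊥-elim (f tt)
monotoneTable⇒monotone {suc k} (p , q , r) {x , true}  {x′ , true}  (le , _) = monotoneTable⇒monotone {k} q le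

monotone⇒monotoneTable : ∀ {k} {f : Table k} → Monotone (lookup f) → MonotoneTable f
monotone⇒monotoneTable {zero}  _ = tt
monotone⇒monotoneTable {suc k} m =
  monotone⇒monotoneTable {k} (λ {q} {q′} le → m {q , false} {q′ , false} (le , λ t → t)) ,
  monotone⇒monotoneTable {k} (λ {q} {q′} le → m {q , true} {q′ , true} (le , λ t → t)) ,
  lookup⇒⊑ᵀ {k} (λ q → m {q , false} {q , true} (≼-refl {k} , λ ()))

Update : ℕ → Set
Update k = Σ (Table k) MonotoneTable

apply : ∀ {k} → Update k → State k → Action
apply (f , _) = lookup f

apply-mono : ∀ {k} (f : Update k) → Monotone (apply f)
apply-mono (_ , m) = monotoneTable⇒monotone m

update : ∀ {k} (F : State k → Action) → Monotone F → Update k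
update F m = tabulate F , monotone⇒monotoneTable (λ {q} {q′} le →
  ℕ.≤-trans (⊑-reflexive (lookup-tabulate F q))
    (ℕ.≤-trans (m le) (⊑-reflexive (sym (lookup-tabulate F q′)))))

apply-injective : ∀ {k} {f g : Update k} → (∀ q → apply f q ≡ apply g q) → f ≡ g
apply-injective {f = f , m} {g , m′} eq with lookup-injective {f = f} {g} eq
... | refl = cong (f ,_) (monotoneTable-irrelevant f m m′)

Finite-Update : ∀ k → Finite (Update k)
Finite-Update k = Finite-Σ (Finite-Table k) (λ f → Finite-Dec (monotoneTable? f) (monotoneTable-irrelevant f))

Cascade : ℕ → Set
Cascade zero    = ⊤
Cascade (suc k) = Cascade k × Update k

act : ∀ {k} → Cascade k → State k → State k
act {zero}  _       _       = tt
act {suc k} (s , f) (q , b) = act s q , apply f q ▹ b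

infix 4 _⊑ᶜ_
_⊑ᶜ_ : ∀ {k} → Cascade k → Cascade k → Set
_⊑ᶜ_ {zero}  _       _       = ⊤
_⊑ᶜ_ {suc k} (s , f) (t , g) = s ⊑ᶜ t × proj₁ f ⊑ᵀ proj₁ g

_⊑ᶜ?_ : ∀ {k} → Binary.Decidable (_⊑ᶜ_ {k})
_⊑ᶜ?_ {zero}  _       _       = yes tt
_⊑ᶜ?_ {suc k} (s , f) (t , g) = (s ⊑ᶜ? t) ×-dec (proj₁ f ⊑ᵀ? proj₁ g)

⊑ᶜ-refl : ∀ {k} {s : Cascade k} → s ⊑ᶜ s
⊑ᶜ-refl {zero}  = tt
⊑ᶜ-refl {suc k} {s , f} = ⊑ᶜ-refl {k} {s} , lookup⇒⊑ᵀ {k} (λ _ → ℕ.≤-refl)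

⊑ᶜ-trans : ∀ {k} {s t u : Cascade k} → s ⊑ᶜ t → t ⊑ᶜ u → s ⊑ᶜ u
⊑ᶜ-trans {zero}  _       _       = tt
⊑ᶜ-trans {suc k} (p , l) (q , m) = ⊑ᶜ-trans {k} p q ,
  lookup⇒⊑ᵀ {k} (λ x → ℕ.≤-trans (⊑ᵀ⇒lookup {k} l x) (⊑ᵀ⇒lookup {k} m x))

⊑ᶜ-antisym : ∀ {k} {s t : Cascade k} → s ⊑ᶜ t → t ⊑ᶜ s → s ≡ t
⊑ᶜ-antisym {zero}  _       _       = refl
⊑ᶜ-antisym {suc k} (p , l) (q , m) = cong₂ _,_ (⊑ᶜ-antisym {k} p q)
  (apply-injective (λ x → ⊑-antisym (⊑ᵀ⇒lookup {k} l x) (⊑ᵀ⇒lookup {k} m x)))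

act-mono : ∀ {k} {s t : Cascade k} {q q′} → s ⊑ᶜ t → q ≼ q′ → act s q ≼ act t q′
act-mono {zero}  _       _       = tt
act-mono {suc k} {s , f} {t , g} {q , _} (p , l) (m , b) = act-mono {k} p m ,
  ▹-mono (ℕ.≤-trans (⊑ᵀ⇒lookup {k} l q) (apply-mono g m)) b

apply-mono₂ : ∀ {k} {f g : Update k} {q q′} → proj₁ f ⊑ᵀ proj₁ g → q ≼ q′ → apply f q ⊑ apply g q′
apply-mono₂ {k} {f} {g} {q} l m = ℕ.≤-trans (⊑ᵀ⇒lookup {k} l q) (apply-mono g m)

infixl 7 _⊙_
_⊙_ : ∀ {k} → Cascade k → Cascade k → Cascade k
_⊙_ {zero}  _       _       = tt
_⊙_ {suc k} (s , f) (t , g) = s ⊙ t , update (λ q → apply f (act t q) · apply g q)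
  (λ m → ·-mono (apply-mono f (act-mono {s = t} {t} (⊑ᶜ-refl {k}) m)) (apply-mono g m))

apply-⊙ : ∀ {k} (s t : Cascade (suc k)) q →
          apply (proj₂ (s ⊙ t)) q ≡ apply (proj₂ s) (act (proj₁ t) q) · apply (proj₂ t) q
apply-⊙ s t = lookup-tabulate _

act-⊙ : ∀ {k} (s t : Cascade k) q → act (s ⊙ t) q ≡ act s (act t q)
act-⊙ {zero}  _ _ _ = refl
act-⊙ {suc k} (s , f) (t , g) (q , b) = cong₂ _,_ (act-⊙ s t q)
  (trans (cong (_▹ b) (apply-⊙ (s , f) (t , g) q)) (·-▹ (apply f (act t q)) (apply g q) b))

⊙-assoc : ∀ {k} (s t u : Cascade k) → s ⊙ t ⊙ u ≡ s ⊙ (t ⊙ u)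
⊙-assoc {zero}  _ _ _ = refl
⊙-assoc {suc k} s@(s₀ , f) t@(t₀ , g) u@(u₀ , h) = cong₂ _,_ (⊙-assoc s₀ t₀ u₀) (apply-injective λ q → begin
  apply (proj₂ (s ⊙ t ⊙ u)) q                                 ≡⟨ apply-⊙ (s ⊙ t) u q ⟩
  apply (proj₂ (s ⊙ t)) (act u₀ q) · apply h q                ≡⟨ cong (_· apply h q) (apply-⊙ s t (act u₀ q)) ⟩
  apply f (act t₀ (act u₀ q)) · apply g (act u₀ q) · apply h q ≡⟨ ·-assoc (apply f (act t₀ (act u₀ q))) _ _ ⟩
  apply f (act t₀ (act u₀ q)) · (apply g (act u₀ q) · apply h q)
    ≡⟨ cong₂ (λ x y → apply f x · y) (act-⊙ t₀ u₀ q) (apply-⊙ t u q) ⟨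
  apply f (act (t₀ ⊙ u₀) q) · apply (proj₂ (t ⊙ u)) q         ≡⟨ apply-⊙ s (t ⊙ u) q ⟨
  apply (proj₂ (s ⊙ (t ⊙ u))) q                               ∎)
  where open ≡-Reasoning

⊙-mono : ∀ {k} {s s′ t t′ : Cascade k} → s ⊑ᶜ s′ → t ⊑ᶜ t′ → s ⊙ t ⊑ᶜ s′ ⊙ t′
⊙-mono {zero}  _ _ = tt
⊙-mono {suc k} {s@(_ , f)} {s′@(_ , f′)} {t@(_ , g)} {t′@(_ , g′)} (p , l) (q , m) = ⊙-mono {k} p q ,
  lookup⇒⊑ᵀ {k} (λ x → ℕ.≤-trans (⊑-reflexive (apply-⊙ s t x)) (ℕ.≤-trans
    (·-mono (apply-mono₂ {f = f} {f′} l (act-mono {k} q ≼-refl)) (⊑ᵀ⇒lookup {k} m x))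
    (⊑-reflexive (sym (apply-⊙ s′ t′ x)))))

𝟙 : ∀ {k} → Cascade k
𝟙 {zero}  = tt
𝟙 {suc k} = 𝟙 , update (λ _ → idle) (λ _ → ℕ.≤-refl)

apply-𝟙 : ∀ {k} q → apply (proj₂ (𝟙 {suc k})) q ≡ idle
apply-𝟙 = lookup-tabulate _

act-𝟙 : ∀ {k} (q : State k) → act 𝟙 q ≡ q
act-𝟙 {zero}  _       = refl
act-𝟙 {suc k} (q , b) = cong₂ _,_ (act-𝟙 q) (cong (_▹ b) (apply-𝟙 q))

⊙-identityˡ : ∀ {k} (s : Cascade k) → 𝟙 ⊙ s ≡ s
⊙-identityˡ {zero}  _ = refl
⊙-identityˡ {suc k} s@(s₀ , f) = cong₂ _,_ (⊙-identityˡ s₀) (apply-injective λ q →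
  trans (apply-⊙ 𝟙 s q) (cong (_· apply f q) (apply-𝟙 (act s₀ q))))

⊙-identityʳ : ∀ {k} (s : Cascade k) → s ⊙ 𝟙 ≡ s
⊙-identityʳ {zero}  _ = refl
⊙-identityʳ {suc k} s@(s₀ , f) = cong₂ _,_ (⊙-identityʳ s₀) (apply-injective λ q →
  trans (apply-⊙ s 𝟙 q) (trans (cong₂ (λ x y → apply f x · y) (act-𝟙 q) (apply-𝟙 q)) (·-identityʳ (apply f q))))

-- Along many repetitions of (e , f) the lower components settle in e ♯ q, so
-- the top one undergoes its first action and then many times that of e ♯ q.
infix 8 _♯
_♯ : ∀ {k} → Cascade k → Cascade k
_♯ {zero}  _       = tt
_♯ {suc k} (e , f) = e ♯ , update (λ q → iter (apply f (act (e ♯) q)) · apply f q)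
  (λ m → ·-mono (iter-mono (apply-mono f (act-mono {s = e ♯} {e ♯} (⊑ᶜ-refl {k}) m))) (apply-mono f m))

apply-♯ : ∀ {k} (s : Cascade (suc k)) q →
          apply (proj₂ (s ♯)) q ≡ iter (apply (proj₂ s) (act (proj₁ s ♯) q)) · apply (proj₂ s) q
apply-♯ s = lookup-tabulate _

-- The first copy leaves the lower components in a fixed point of `e ♯`, where the second acts by
-- `iter x · x`; `iter-absorb` swallows this. Idempotence of `s ♯` at one level thus feeds the fixed
-- point used at the next.
♯♯-idem : ∀ {k} (s : Cascade k) → s ♯ ⊙ s ♯ ≡ s ♯
act-♯-fix : ∀ {k} (s : Cascade k) q → act (s ♯) (act (s ♯) q) ≡ act (s ♯) q

act-♯-fix s q = trans (sym (act-⊙ (s ♯) (s ♯) q)) (cong (λ t → act t q) (♯♯-idem s))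

apply-♯-fix : ∀ {k} (s : Cascade (suc k)) q → let x = apply (proj₂ s) (act (proj₁ s ♯) q) in
              apply (proj₂ (s ♯)) (act (proj₁ s ♯) q) ≡ iter x · x

♯♯-idem {zero}  _ = refl
♯♯-idem {suc k} s@(e , f) = cong₂ _,_ (♯♯-idem e) (apply-injective λ q → begin
  apply (proj₂ (s ♯ ⊙ s ♯)) q                                   ≡⟨ apply-⊙ (s ♯) (s ♯) q ⟩
  apply (proj₂ (s ♯)) (act (e ♯) q) · apply (proj₂ (s ♯)) q     ≡⟨ cong₂ _·_ (apply-♯-fix s q) (apply-♯ s q) ⟩
  iter (apply f (act (e ♯) q)) · apply f (act (e ♯) q) · (iter (apply f (act (e ♯) q)) · apply f q)
    ≡⟨ iter-absorb (apply f (act (e ♯) q)) (apply f q) ⟩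
  iter (apply f (act (e ♯) q)) · apply f q                      ≡⟨ apply-♯ s q ⟨
  apply (proj₂ (s ♯)) q                                         ∎)
  where open ≡-Reasoning

apply-♯-fix s@(e , f) q = trans (apply-♯ s (act (e ♯) q))
  (cong (λ p → iter (apply f p) · apply f (act (e ♯) q)) (act-♯-fix e q))

♯-♯′ : ∀ {k} (s : Cascade k) → s ♯ ♯ ≡ s ♯
♯-♯′ {zero}  _ = refl
♯-♯′ {suc k} s@(e , f) = cong₂ _,_ (♯-♯′ e) (apply-injective λ q → begin
  apply (proj₂ (s ♯ ♯)) q                                  ≡⟨ apply-♯ (s ♯) q ⟩
  iter (apply (proj₂ (s ♯)) (act (e ♯ ♯) q)) · apply (proj₂ (s ♯)) q
    ≡⟨ cong (λ t → iter (apply (proj₂ (s ♯)) (act t q)) · apply (proj₂ (s ♯)) q) (♯-♯′ e) ⟩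
  iter (apply (proj₂ (s ♯)) (act (e ♯) q)) · apply (proj₂ (s ♯)) q
    ≡⟨ cong₂ (λ x y → iter x · y) (apply-♯-fix s q) (apply-♯ s q) ⟩
  iter (iter (apply f (act (e ♯) q)) · apply f (act (e ♯) q)) · (iter (apply f (act (e ♯) q)) · apply f q)
    ≡⟨ iter-iter (apply f (act (e ♯) q)) (apply f q) ⟩
  iter (apply f (act (e ♯) q)) · apply f q                 ≡⟨ apply-♯ s q ⟨
  apply (proj₂ (s ♯)) q                                    ∎)
  where open ≡-Reasoning

⊙-♯ : ∀ {k} (s : Cascade k) → s ⊙ s ♯ ≡ s ♯
⊙-♯ {zero}  _ = refl
⊙-♯ {suc k} s@(e , f) = cong₂ _,_ (⊙-♯ e) (apply-injective λ q → let x = apply f (act (e ♯) q) in begin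
  apply (proj₂ (s ⊙ s ♯)) q         ≡⟨ apply-⊙ s (s ♯) q ⟩
  x · apply (proj₂ (s ♯)) q         ≡⟨ cong (x ·_) (apply-♯ s q) ⟩
  x · (iter x · apply f q)          ≡⟨ ·-assoc x (iter x) (apply f q) ⟨
  x · iter x · apply f q            ≡⟨ cong (_· apply f q) (·-iter x) ⟩
  iter x · apply f q                ≡⟨ apply-♯ s q ⟨
  apply (proj₂ (s ♯)) q             ∎)
  where open ≡-Reasoning

idem-apply : ∀ {k} {s : Cascade (suc k)} → s ⊙ s ≡ s → ∀ q →
             apply (proj₂ s) (act (proj₁ s) q) · apply (proj₂ s) q ≡ apply (proj₂ s) q
idem-apply {s = s} i q = trans (sym (apply-⊙ s s q)) (cong (λ t → apply (proj₂ t) q) i)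

-- By idempotence the action in state `act e q` leaves `apply f q` unchanged. The settled state is
-- smaller, hence so is its action, and iterating it can only lower the result.
♯-⊑ : ∀ {k} {s : Cascade k} → s ⊙ s ≡ s → s ♯ ⊑ᶜ s
♯-⊑ {zero}  _ = tt
♯-⊑ {suc k} {s@(e , f)} i = ♯-⊑ {k} e-idem , lookup⇒⊑ᵀ {k} (λ q →
  ℕ.≤-trans (⊑-reflexive (apply-♯ s q))
    (iter-⊑ {y = apply f (act e q)} (apply-mono f (act-mono {k} (♯-⊑ {k} e-idem) ≼-refl)) (idem-apply {s = s} i q)))
  where
  e-idem : e ⊙ e ≡ e
  e-idem = cong proj₁ i

♯-mono′ : ∀ {k} {s t : Cascade k} → s ⊑ᶜ t → s ♯ ⊑ᶜ t ♯
♯-mono′ {zero}  _ = tt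
♯-mono′ {suc k} {s@(_ , f)} {t@(_ , g)} (p , l) = ♯-mono′ {k} p , lookup⇒⊑ᵀ {k} (λ q →
  ℕ.≤-trans (⊑-reflexive (apply-♯ s q)) (ℕ.≤-trans
    (·-mono (iter-mono (apply-mono₂ {f = f} {g} l (act-mono {k} (♯-mono′ {k} p) ≼-refl))) (⊑ᵀ⇒lookup {k} l q))
    (⊑-reflexive (sym (apply-♯ t q)))))

-- By `swap`, reading `b` carries the settled state of `a ⊙ b` to that of `b ⊙ a`, so both sides
-- iterate the same two actions on the top counter.
♯-conj′ : ∀ {k} {s t : Cascade k} → (s ⊙ t) ⊙ (s ⊙ t) ≡ s ⊙ t → (s ⊙ t) ♯ ≡ s ⊙ (t ⊙ s) ♯ ⊙ t
♯-conj′ {zero} _ = refl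
♯-conj′ {suc k} {s@(a , f)} {t@(b , g)} i = cong₂ _,_ conj (apply-injective λ q →
  let x = apply f (act b (act ((a ⊙ b) ♯) q))
      y = apply g (act ((a ⊙ b) ♯) q)
      y′ = apply g (act (a ⊙ b) q)
      r = act b q
      z = apply f r · apply g q
  in begin
  apply (proj₂ ((s ⊙ t) ♯)) q                                ≡⟨ apply-♯ (s ⊙ t) q ⟩
  iter (apply (proj₂ (s ⊙ t)) (act ((a ⊙ b) ♯) q)) · apply (proj₂ (s ⊙ t)) q
    ≡⟨ cong₂ (λ v w → iter v · w) (apply-⊙ s t (act ((a ⊙ b) ♯) q)) (apply-⊙ s t q) ⟩
  iter (x · y) · z
    ≡⟨ iter-conj {x} {apply f (act b (act (a ⊙ b) q))} {y} {y′} {z}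
         (apply-mono f (act-mono {s = b} (⊑ᶜ-refl {k}) (act-mono {k} (♯-⊑ {k} (cong proj₁ i)) ≼-refl)))
         (apply-mono g (act-mono {k} (♯-⊑ {k} (cong proj₁ i)) ≼-refl))
         (trans (sym (·-assoc (apply f (act b (act (a ⊙ b) q))) y′ z))
           (trans (sym (cong₂ _·_ (apply-⊙ s t (act (a ⊙ b) q)) (apply-⊙ s t q)))
             (trans (idem-apply {s = s ⊙ t} i q) (apply-⊙ s t q)))) ⟩
  x · (iter (y · x) · (y′ · z))
    ≡⟨ cong (x ·_) (trans (cong (iter (y · x) ·_) (sym (·-assoc y′ (apply f r) (apply g q))))
         (sym (·-assoc (iter (y · x)) (y′ · apply f r) (apply g q)))) ⟩
  x · (iter (y · x) · (y′ · apply f r) · apply g q)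
    ≡⟨ ·-assoc x (iter (y · x) · (y′ · apply f r)) (apply g q) ⟨
  x · (iter (y · x) · (y′ · apply f r)) · apply g q
    ≡⟨ cong (λ w → w · apply g q) (cong₂ _·_ (cong (apply f) (swap q))
         (cong₂ (λ v w → iter v · w) (cong₂ _·_ (cong (apply g) (round q)) (cong (apply f) (swap q)))
           (cong (λ w → apply g w · apply f r) (act-⊙ a b q)))) ⟩
  apply f (act ((b ⊙ a) ♯) r) · (iter (apply g (act a (act ((b ⊙ a) ♯) r)) · apply f (act ((b ⊙ a) ♯) r))
    · (apply g (act a r) · apply f r)) · apply g q
    ≡⟨ cong (λ w → apply f (act ((b ⊙ a) ♯) r) · w · apply g q)
         (trans (apply-♯ (t ⊙ s) r) (cong₂ (λ v w → iter v · w) (apply-⊙ t s (act ((b ⊙ a) ♯) r)) (apply-⊙ t s r))) ⟨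
  apply f (act ((b ⊙ a) ♯) r) · apply (proj₂ ((t ⊙ s) ♯)) r · apply g q
    ≡⟨ cong (_· apply g q) (apply-⊙ s ((t ⊙ s) ♯) r) ⟨
  apply (proj₂ (s ⊙ (t ⊙ s) ♯)) r · apply g q                ≡⟨ apply-⊙ (s ⊙ (t ⊙ s) ♯) t q ⟨
  apply (proj₂ (s ⊙ (t ⊙ s) ♯ ⊙ t)) q                        ∎)
  where
  open ≡-Reasoning
  conj : (a ⊙ b) ♯ ≡ a ⊙ (b ⊙ a) ♯ ⊙ b
  conj = ♯-conj′ {k} (cong proj₁ i)
  round : ∀ q → act ((a ⊙ b) ♯) q ≡ act a (act ((b ⊙ a) ♯) (act b q))
  round q = trans (cong (λ u → act u q) conj) (trans (act-⊙ (a ⊙ (b ⊙ a) ♯) b q) (act-⊙ a ((b ⊙ a) ♯) (act b q)))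
  swap : ∀ q → act b (act ((a ⊙ b) ♯) q) ≡ act ((b ⊙ a) ♯) (act b q)
  swap q = begin
    act b (act ((a ⊙ b) ♯) q)                   ≡⟨ cong (act b) (round q) ⟩
    act b (act a (act ((b ⊙ a) ♯) (act b q)))   ≡⟨ act-⊙ b a _ ⟨
    act (b ⊙ a) (act ((b ⊙ a) ♯) (act b q))     ≡⟨ act-⊙ (b ⊙ a) ((b ⊙ a) ♯) (act b q) ⟨
    act ((b ⊙ a) ⊙ (b ⊙ a) ♯) (act b q)         ≡⟨ cong (λ u → act u (act b q)) (⊙-♯ (b ⊙ a)) ⟩
    act ((b ⊙ a) ♯) (act b q)                   ∎

𝟙-♯ : ∀ {k} → 𝟙 {k} ♯ ≡ 𝟙
𝟙-♯ {zero}  = refl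
𝟙-♯ {suc k} = cong₂ _,_ 𝟙-♯ (apply-injective λ q → trans (apply-♯ 𝟙 q)
  (trans (cong₂ (λ x y → iter x · y) (apply-𝟙 (act (𝟙 ♯) q)) (apply-𝟙 q)) (sym (apply-𝟙 q))))

-- The cascade as an aperiodic stabilization monoid.

Finite-Cascade : ∀ k → Finite (Cascade k)
Finite-Cascade zero    = 1 , mk↔ₛ′ (λ _ → zero) (λ _ → tt) (λ { zero → refl }) (λ _ → refl)
Finite-Cascade (suc k) = Finite-Σ (Finite-Cascade k) (λ _ → Finite-Update k)

cascade : ℕ → StabilizationSemigroup
cascade k = record
  { Carrier        = Cascade k
  ; finite         = Finite-Cascade k
  ; _∙_            = _⊙_
  ; isSemigroup    = record
    { isMagma = record { isEquivalence = isEquivalence ; ∙-cong = cong₂ _⊙_ }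
    ; assoc   = ⊙-assoc
    }
  ; _≤ˢ_           = _⊑ᶜ_
  ; isPartialOrder = record
    { isPreorder = record
      { isEquivalence = isEquivalence
      ; reflexive     = λ { refl → ⊑ᶜ-refl {k} }
      ; trans         = ⊑ᶜ-trans {k}
      }
    ; antisym    = ⊑ᶜ-antisym {k}
    }
  ; ∙-mono         = ⊙-mono {k}
  ; _♯[_]          = λ e _ → e ♯
  ; ♯-idem         = λ {e} _ → ♯♯-idem e
  ; ♯-conj         = λ i _ → ♯-conj′ i
  ; ♯-♯            = λ {e} _ → ♯-♯′ e
  ; ♯-≤            = ♯-⊑ {k}
  ; ♯-mono         = λ _ _ → ♯-mono′ {k}
  }

cascade-identity : ∀ k → Identity _≡_ 𝟙 (_⊙_ {k})
cascade-identity k = ⊙-identityˡ , ⊙-identityʳ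

cascade-neutralStable : ∀ k → StabilizationSemigroup.NeutralStable (cascade k)
cascade-neutralStable k {ε} (idˡ , idʳ) i = subst (λ s → s ♯ ≡ s) (trans (sym (idˡ 𝟙)) (⊙-identityʳ ε)) 𝟙-♯

module _ {k : ℕ} where
  open StabilizationSemigroup (cascade k) public using () renaming (_^1+_ to _^ᶜ1+_)

proj₁-^1+ : ∀ {k} (s : Cascade (suc k)) j → proj₁ (s ^ᶜ1+ j) ≡ proj₁ s ^ᶜ1+ j
proj₁-^1+ s zero    = refl
proj₁-^1+ s (suc j) = cong (proj₁ s ⊙_) (proj₁-^1+ s j)

-- Once the lower components are stable, the top counter undergoes one and the same idempotent
-- action, so each level costs one more power.
cascade-aperiodic : ∀ k (s : Cascade k) → s ^ᶜ1+ suc k ≡ s ^ᶜ1+ k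
cascade-aperiodic zero    _ = refl
cascade-aperiodic (suc k) s@(s₀ , f) = cong₂ _,_ (cong (s₀ ⊙_) stable) (apply-injective λ q → begin
  apply (proj₂ (s ⊙ (s ⊙ p))) q                              ≡⟨ apply-⊙ s (s ⊙ p) q ⟩
  apply f (act (s₀ ⊙ p₀) q) · apply (proj₂ (s ⊙ p)) q
    ≡⟨ cong₂ (λ t y → apply f (act t q) · y) stable (apply-⊙ s p q) ⟩
  apply f (act p₀ q) · (apply f (act p₀ q) · apply (proj₂ p) q) ≡⟨ ·-assoc (apply f (act p₀ q)) _ _ ⟨
  apply f (act p₀ q) · apply f (act p₀ q) · apply (proj₂ p) q   ≡⟨ cong (_· apply (proj₂ p) q) (·-idem (apply f (act p₀ q))) ⟩
  apply f (act p₀ q) · apply (proj₂ p) q                     ≡⟨ apply-⊙ s p q ⟨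
  apply (proj₂ (s ⊙ p)) q                                    ∎)
  where
  open ≡-Reasoning
  p : Cascade (suc k)
  p = s ^ᶜ1+ k
  p₀ : Cascade k
  p₀ = proj₁ p
  stable : s₀ ⊙ p₀ ≡ p₀
  stable = trans (cong (s₀ ⊙_) (proj₁-^1+ s k)) (trans (cascade-aperiodic k s₀) (sym (proj₁-^1+ s k)))

-- Soundness of trees with respect to counters

Counters : ℕ → Set
Counters zero    = ⊤
Counters (suc k) = Counters k × ℕ

Path : ∀ {k} → (Cascade k → Counters k → Counters k → Set) → List (Cascade k) → Counters k → Counters k → Set
Path R []      c c″ = c ≡ c″
Path R (s ∷ u) c c″ = ∃[ c′ ] Path R u c c′ × R s c′ c″

path-++ : ∀ {k} {R : Cascade k → Counters k → Counters k → Set} u {v c c″} →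
          Path R (u ++ v) c c″ → ∃[ c′ ] Path R v c c′ × Path R u c′ c″
path-++ []      p           = _ , p , refl
path-++ (s ∷ u) (_ , p , r) = let _ , p , p′ = path-++ u p in _ , p , _ , p′ , r

-- A counter is considered to be infinite as soon as it exceeds m.
module Simulation (m : ℕ) where

  -- Counter bounds from above.

  UpperAction : ℕ → Action → ℕ → ℕ → Set
  UpperAction K bot  x x′ = ⊤
  UpperAction K inc  x x′ = x′ ≤ K + x
  UpperAction K idle x x′ = x′ ≤ x
  UpperAction K set  x x′ = x′ ≤ K

  upperAction-weaken : ∀ {K L x x′} a → K ≤ L → UpperAction K a x x′ → UpperAction L a x x′
  upperAction-weaken bot  le _ = tt
  upperAction-weaken {x = x} inc le p = ℕ.≤-trans p (ℕ.+-monoˡ-≤ x le)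
  upperAction-weaken idle le p = p
  upperAction-weaken set  le p = ℕ.≤-trans p le

  upperAction-· : ∀ {K L x x′ x″} a b → UpperAction K a x′ x″ → UpperAction L b x x′ → UpperAction (K + L) (a · b) x x″
  upperAction-· bot  b p q = tt
  upperAction-· {K} {L} set b p q = ℕ.≤-trans p (ℕ.m≤m+n K L)
  upperAction-· {K} {L} idle bot  p q = tt
  upperAction-· {K} {L} {x} idle inc p q =
    ℕ.≤-trans p (ℕ.≤-trans q (ℕ.+-monoˡ-≤ x (ℕ.m≤n+m L K)))
  upperAction-· idle idle p q = ℕ.≤-trans p q
  upperAction-· {K} {L} idle set p q = ℕ.≤-trans p (ℕ.≤-trans q (ℕ.m≤n+m L K))
  upperAction-· inc bot p q = tt
  upperAction-· {K} {L} {x} inc inc p q =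
    ℕ.≤-trans p (ℕ.≤-trans (ℕ.+-monoʳ-≤ K q) (ℕ.≤-reflexive (sym (ℕ.+-assoc K L x))))
  upperAction-· {K} {L} {x} inc idle p q =
    ℕ.≤-trans p (ℕ.≤-trans (ℕ.+-monoʳ-≤ K q) (ℕ.+-monoˡ-≤ x (ℕ.m≤m+n K L)))
  upperAction-· {K} inc set p q = ℕ.≤-trans p (ℕ.+-monoʳ-≤ K q)

  upperAction-♯-one : ∀ {K x x′ r y z} → r ⊑ y → y · z ≡ z →
    UpperAction K z x x′ → UpperAction (K + K) (iter r · z) x x′
  upperAction-♯-one {r = bot}  _ _ p = tt
  upperAction-♯-one {r = inc}  _ _ p = tt
  upperAction-♯-one {K} {r = idle} {z = z} _ _ p = upperAction-weaken z (ℕ.m≤m+n K K) p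
  upperAction-♯-one {K} {r = set} {set} _ refl p = ℕ.≤-trans p (ℕ.m≤m+n K K)
  upperAction-♯-one {r = set} {idle} (s≤s (s≤s ()))
  upperAction-♯-one {r = set} {inc} (s≤s ())

  upperAction-♯-step : ∀ {K x x′ x″} r z →
    UpperAction (K + K) (iter r · z) x x′ → UpperAction K r x′ x″ → UpperAction (K + K) (iter r · z) x x″
  upperAction-♯-step bot  z p q = tt
  upperAction-♯-step inc  z p q = tt
  upperAction-♯-step {K} set z p q = ℕ.≤-trans q (ℕ.m≤m+n K K)
  upperAction-♯-step idle bot  p q = tt
  upperAction-♯-step idle inc  p q = ℕ.≤-trans q p
  upperAction-♯-step idle idle p q = ℕ.≤-trans q p
  upperAction-♯-step idle set  p q = ℕ.≤-trans q p

  -- `K` is slack: a counter declared small may still suffer an error of `K` without exceeding the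
  -- threshold.
  Under : ∀ {k} → ℕ → State k → Counters k → Set
  Under {zero}  K _       _       = ⊤
  Under {suc k} K (q , b) (c , x) = Under K q c × (T b → K + x ≤ m)

  Upper : ∀ {k} → ℕ → Cascade k → Counters k → Counters k → Set
  Upper {zero}  K _       _       _         = ⊤
  Upper {suc k} K (s , f) (c , x) (c′ , x′) =
    Upper K s c c′ × (∀ q → Under K q c → UpperAction K (apply f q) x x′)

  under-weaken : ∀ {k K L} {q : State k} {c} → K ≤ L → Under L q c → Under K q c
  under-weaken {zero}  le _       = tt
  under-weaken {suc k} {c = _ , x} le (u , h) = under-weaken {k} le u , λ t → ℕ.≤-trans (ℕ.+-monoˡ-≤ x le) (h t)

  under-≼ : ∀ {k K} {q q′ : State k} {c} → q ≼ q′ → Under K q′ c → Under K q c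
  under-≼ {zero}  _       _       = tt
  under-≼ {suc k} (l , b) (u , h) = under-≼ {k} l u , λ t → h (b t)

  upper-weaken : ∀ {k K L} {s : Cascade k} {c c′} → K ≤ L → Upper K s c c′ → Upper L s c c′
  upper-weaken {zero} le _ = tt
  upper-weaken {suc k} {s = _ , f} le (u , h) = upper-weaken {k} le u , λ q un →
    upperAction-weaken (apply f q) le (h q (under-weaken {k} le un))

  upperAction-▹ : ∀ {K L x x′ b} a → K + L ≤ m → UpperAction L a x x′ → (T b → (K + L) + x ≤ m) →
                  T (a ▹ b) → K + x′ ≤ m
  upperAction-▹ {K} {L} {x} inc le p h t =
    ℕ.≤-trans (ℕ.+-monoʳ-≤ K p) (ℕ.≤-trans (ℕ.≤-reflexive (sym (ℕ.+-assoc K L x))) (h t))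
  upperAction-▹ {K} {L} {x} idle le p h t = ℕ.≤-trans (ℕ.+-mono-≤ (ℕ.m≤m+n K L) p) (h t)
  upperAction-▹ {K} set le p h t = ℕ.≤-trans (ℕ.+-monoʳ-≤ K p) le

  upper-act : ∀ {k K L} {s : Cascade k} {c c′} q → K + L ≤ m → Upper L s c c′ →
              Under (K + L) q c → Under K (act s q) c′
  upper-act {zero} _ _ _ _ = tt
  upper-act {suc k} {K} {L} {s = _ , f} (q , b) le (u , h) (un , hb) = upper-act {k} q le u un ,
    upperAction-▹ (apply f q) le (h q (under-weaken {k} (ℕ.m≤n+m L K) un)) hb

  upper-⊙ : ∀ {k K L} {s t : Cascade k} {c c′ c″} → K + L ≤ m →
            Upper K s c′ c″ → Upper L t c c′ → Upper (K + L) (s ⊙ t) c c″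
  upper-⊙ {zero} _ _ _ = tt
  upper-⊙ {suc k} {K} {L} {s@(_ , f)} {t@(t₀ , g)} le (u , h) (u′ , h′) = upper-⊙ {k} le u u′ , λ q un →
    subst (λ a → UpperAction (K + L) a _ _) (sym (apply-⊙ s t q))
      (upperAction-· (apply f (act t₀ q)) (apply g q)
        (h (act t₀ q) (upper-act {k} q le u′ un)) (h′ q (under-weaken {k} (ℕ.m≤n+m L K) un)))

  -- The invariant for repetitions of `e`. Of the slack `K + K`, the first copy consumes `K`; later
  -- copies consume nothing, so the error does not depend on their number.
  Settled : ∀ {k} → ℕ → Cascade k → Counters k → Counters k → Set
  Settled K e c c′ = Upper (K + K) (e ♯) c c′ × (∀ q → Under (K + K) q c → Under K (act (e ♯) q) c′)

  upper-♯-one : ∀ {k K} {e : Cascade k} {c c′} → e ⊙ e ≡ e → Upper K e c c′ → Upper (K + K) (e ♯) c c′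
  upper-♯-one {zero} _ _ = tt
  upper-♯-one {suc k} {K} {s@(e , f)} i (u , h) = upper-♯-one {k} (cong proj₁ i) u , λ q un →
    subst (λ a → UpperAction (K + K) a _ _) (sym (apply-♯ s q))
      (upperAction-♯-one {y = apply f (act e q)}
        (apply-mono f (act-mono {k} (♯-⊑ {k} (cong proj₁ i)) ≼-refl)) (idem-apply {s = s} i q)
        (h q (under-weaken {k} (ℕ.m≤m+n K K) un)))

  upper-♯-step : ∀ {k K} {e : Cascade k} {c c′ c″} → Settled K e c c′ → Upper K e c′ c″ → Upper (K + K) (e ♯) c c″
  upper-♯-step {zero} _ _ = tt
  upper-♯-step {suc k} {K} {s@(e , f)} ((u , h) , under) (u′ , h′) =
    upper-♯-step {k} (u , under₀) u′ , λ q un →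
    subst (λ a → UpperAction (K + K) a _ _) (sym (apply-♯ s q))
      (upperAction-♯-step (apply f (act (e ♯) q)) (apply f q)
        (subst (λ a → UpperAction (K + K) a _ _) (apply-♯ s q) (h q un))
        (h′ (act (e ♯) q) (under₀ q un)))
    where
    under₀ : ∀ q → Under (K + K) q _ → Under K (act (e ♯) q) _
    under₀ q un = proj₁ (under (q , false) (un , λ ()))

  -- The state e ♯ q no longer counts on the counters that e keeps increasing.
  under-♯-step : ∀ {k K} {e : Cascade k} {c c′} q → K + K ≤ m → Upper K e c c′ →
                 Under K (act (e ♯) q) c → Under K (act (e ♯) q) c′
  under-♯-step {zero} _ _ _ _ = tt
  under-♯-step {suc k} {K} {s@(e , f)} {_ , x} {_ , x′} (q , b) le (u , h) (un , hb) = under-♯-step {k} q le u un ,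
    λ t → stay (apply f (act (e ♯) q)) (apply f q) (h (act (e ♯) q) un)
      (λ t → hb (subst (λ a → T (a ▹ b)) (sym (apply-♯ s q)) t))
      (subst (λ a → T (a ▹ b)) (apply-♯ s q) t)
    where
    stay : ∀ r z → UpperAction K r x x′ → (T ((iter r · z) ▹ b) → K + x ≤ m) → T ((iter r · z) ▹ b) → K + x′ ≤ m
    stay set  z p h t = ℕ.≤-trans (ℕ.+-monoʳ-≤ K p) le
    stay idle z p h t = ℕ.≤-trans (ℕ.+-monoʳ-≤ K p) (h t)

  settled-one : ∀ {k K} {e : Cascade k} {c c′} → K + K ≤ m → e ⊙ e ≡ e → Upper K e c c′ → Settled K e c c′
  settled-one {k} le i u = upper-♯-one {k} i u ,
    λ q un → under-≼ {k} (act-mono {k} (♯-⊑ {k} i) ≼-refl) (upper-act {k} q le u un)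

  settled-step : ∀ {k K} {e : Cascade k} {c c′ c″} → K + K ≤ m → Settled K e c c′ → Upper K e c′ c″ → Settled K e c c″
  settled-step {k} le st u = upper-♯-step {k} st u , λ q un → under-♯-step {k} q le u (proj₂ st q un)

  module _ {k n : ℕ} where
    open StabilizationSemigroup (cascade k) using (Tree; leaf; binary; idempotent; stabilization; Forest; one; _∷_; height; heightᶠ)

    -- A binary or stabilization node doubles the error, an idempotent node multiplies it by at most
    -- `n`; `2 + n` covers both.
    bound : ℕ → ℕ
    bound h = (2 + n) ^ h

    bound-suc : ∀ h j → j ≤ 2 + n → j * bound h ≤ bound (suc h)
    bound-suc h j le = ℕ.*-monoˡ-≤ (bound h) le

    double : ∀ h → bound h + bound h ≤ bound (suc h)
    double h = ℕ.≤-trans (ℕ.≤-reflexive (cong (bound h +_) (sym (ℕ.+-identityʳ (bound h))))) (bound-suc h 2 (s≤s (s≤s z≤n)))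

    upper-tree : ∀ {u s c c′} (t : Tree n u s) {h} → height t ≤ h → bound h ≤ m →
                 Path (Upper 1) (toList u) c c′ → Upper (bound h) s c c′
    upper-idem : ∀ {u e j c c′} → e ⊙ e ≡ e → (ts : Forest n e j u) → ∀ {h} → heightᶠ ts ≤ h →
                 j * bound h ≤ m → bound h ≤ m →
                 Path (Upper 1) (toList u) c c′ → Upper (j * bound h) e c c′
    upper-♯ : ∀ {u e j c c′} → e ⊙ e ≡ e → (ts : Forest n e j u) → ∀ {h} → heightᶠ ts ≤ h → bound (suc h) ≤ m →
              Path (Upper 1) (toList u) c c′ → Settled (bound h) e c c′

    upper-tree (leaf s) {h} _ _ (_ , refl , u) = upper-weaken {k} (ℕ.m^n>0 (2 + n) h) u
    upper-tree (binary {u} t t′) {suc h} (s≤s l) le p =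
      let _ , p , p′ = path-++ (toList u) p
          bh≤m = ℕ.≤-trans (ℕ.m≤m+n _ _) le
      in upper-weaken {k} (double h) (upper-⊙ {k} (ℕ.≤-trans (double h) le)
        (upper-tree t (ℕ.m⊔n≤o⇒m≤o _ _ l) bh≤m p′) (upper-tree t′ (ℕ.m⊔n≤o⇒n≤o (height t) _ l) bh≤m p))
    upper-tree (idempotent {k = j} i j≤n ts) {suc h} (s≤s l) le p =
      upper-weaken {k} j≤ (upper-idem i ts l (ℕ.≤-trans j≤ le) (ℕ.≤-trans (ℕ.m≤m+n _ _) le) p)
      where
      j≤ : j * bound h ≤ bound (suc h)
      j≤ = bound-suc h j (ℕ.m≤n⇒m≤1+n (ℕ.m≤n⇒m≤1+n j≤n))
    upper-tree (stabilization i n<j ts) {suc h} (s≤s l) le p =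
      upper-weaken {k} (double h) (proj₁ (upper-♯ i ts l le p))

    upper-idem i (one t) {h} l le _ p = upper-weaken {k} (ℕ.m≤m+n _ _) (upper-tree t l (ℕ.≤-trans (ℕ.m≤m+n _ _) le) p)
    upper-idem i (_∷_ {u} t ts) {h} l le bh≤m p =
      let _ , p , p′ = path-++ (toList u) p
      in subst (λ s → Upper _ s _ _) i (upper-⊙ {k} {bound h} le
        (upper-tree t (ℕ.m⊔n≤o⇒m≤o _ _ l) bh≤m p′)
        (upper-idem i ts (ℕ.m⊔n≤o⇒n≤o (height t) _ l) (ℕ.≤-trans (ℕ.m≤n+m _ (bound h)) le) bh≤m p))

    upper-♯ i (one t) {h} l le p =
      settled-one {k} (ℕ.≤-trans (double h) le) i (upper-tree t l (ℕ.≤-trans (ℕ.m≤m+n _ _) le) p)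
    upper-♯ i (_∷_ {u} t ts) {h} l le p =
      let _ , p , p′ = path-++ (toList u) p
      in settled-step {k} (ℕ.≤-trans (double h) le) (upper-♯ i ts (ℕ.m⊔n≤o⇒n≤o (height t) _ l) le p)
        (upper-tree t (ℕ.m⊔n≤o⇒m≤o _ _ l) (ℕ.≤-trans (ℕ.m≤m+n _ _) le) p′)

  -- Counter bounds from below.

  LowerAction : Action → ℕ → ℕ → Set
  LowerAction bot  x x′ = ¬ x′ ≤ m
  LowerAction inc  x x′ = x′ ≤ m → x < x′
  LowerAction idle x x′ = x′ ≤ m → x ≤ x′
  LowerAction set  x x′ = ⊤

  lowerAction-· : ∀ {x x′ x″} a b → LowerAction a x′ x″ → LowerAction b x x′ → LowerAction (a · b) x x″
  lowerAction-· bot  b    p q = p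
  lowerAction-· set  b    p q = tt
  lowerAction-· idle bot  p q = λ l → q (ℕ.≤-trans (p l) l)
  lowerAction-· idle inc  p q = λ l → ℕ.<-≤-trans (q (ℕ.≤-trans (p l) l)) (p l)
  lowerAction-· idle idle p q = λ l → ℕ.≤-trans (q (ℕ.≤-trans (p l) l)) (p l)
  lowerAction-· idle set  p q = tt
  lowerAction-· inc  bot  p q = λ l → q (ℕ.<⇒≤ (ℕ.<-≤-trans (p l) l))
  lowerAction-· inc  inc  p q = λ l → ℕ.<-trans (q (ℕ.<⇒≤ (ℕ.<-≤-trans (p l) l))) (p l)
  lowerAction-· inc  idle p q = λ l → ℕ.≤-<-trans (q (ℕ.<⇒≤ (ℕ.<-≤-trans (p l) l))) (p l)
  lowerAction-· inc  set  p q = tt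

  lowerAction-▹ : ∀ {x x′ b} a → LowerAction a x x′ → (x ≤ m → T b) → x′ ≤ m → T (a ▹ b)
  lowerAction-▹ bot  p h l = p l
  lowerAction-▹ inc  p h l = h (ℕ.<⇒≤ (ℕ.<-≤-trans (p l) l))
  lowerAction-▹ idle p h l = h (ℕ.≤-trans (p l) l)
  lowerAction-▹ set  p h l = tt

  Over : ∀ {k} → State k → Counters k → Set
  Over {zero}  _       _       = ⊤
  Over {suc k} (q , b) (c , x) = Over q c × (x ≤ m → T b)

  Lower : ∀ {k} → Cascade k → Counters k → Counters k → Set
  Lower {zero}  _       _       _         = ⊤
  Lower {suc k} (s , f) (c , x) (c′ , x′) =
    Lower s c c′ × (∀ q → Over q c → LowerAction (apply f q) x x′)

  lower-act : ∀ {k} {s : Cascade k} {c c′} q → Lower s c c′ → Over q c → Over (act s q) c′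
  lower-act {zero} _ _ _ = tt
  lower-act {suc k} {_ , f} (q , b) (l , h) (o , hb) =
    lower-act {k} q l o , lowerAction-▹ (apply f q) (h q o) hb

  lower-⊙ : ∀ {k} {s t : Cascade k} {c c′ c″} → Lower s c′ c″ → Lower t c c′ → Lower (s ⊙ t) c c″
  lower-⊙ {zero} _ _ = tt
  lower-⊙ {suc k} {s@(_ , f)} {t@(t₀ , g)} (l , h) (l′ , h′) = lower-⊙ {k} l l′ , λ q o →
    subst (λ a → LowerAction a _ _) (sym (apply-⊙ s t q))
      (lowerAction-· (apply f (act t₀ q)) (apply g q) (h (act t₀ q) (lower-act {k} q l′ o)) (h′ q o))

  settlingTime : ℕ → ℕ
  settlingTime zero    = 0
  settlingTime (suc k) = settlingTime k + suc m

  -- `t` counts the copies of `e` read so far. The lower levels are known to have settled only after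
  -- more than `settlingTime k` copies, so the first guaranteed increase comes one copy later; hence
  -- the `suc`.
  Progress : ∀ {k} → ℕ → Cascade k → Counters k → Counters k → Set
  Progress {zero}  t _       _       _         = ⊤
  Progress {suc k} t (e , f) (c , x) (c′ , x′) = Progress t e c c′ ×
    (∀ q → Over q c → iter (apply f (act (e ♯) q)) ≡ bot → x′ ≤ m → t ≤ settlingTime k + suc x′)

  progress-one : ∀ {k} {e : Cascade k} {c c′} → Progress 1 e c c′
  progress-one {zero}  = tt
  progress-one {suc k} {_} {_} {_ , x′} = progress-one {k} , λ _ _ _ _ →
    ℕ.≤-trans (s≤s z≤n) (ℕ.m≤n+m (suc x′) (settlingTime k))

  progress⇒lower-♯ : ∀ {k t} {e : Cascade k} {c c′} → settlingTime k < t →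
                     Lower e c c′ → Progress t e c c′ → Lower (e ♯) c c′
  progress⇒lower-♯ {zero} _ _ _ = tt
  progress⇒lower-♯ {suc k} {t} {s@(e , f)} {_ , x} {_ , x′} lt (l , h) (p , hp) =
    progress⇒lower-♯ {k} (ℕ.≤-<-trans (ℕ.m≤m+n _ _) lt) l p , λ q o →
    subst (λ a → LowerAction a x x′) (sym (apply-♯ s q))
      (final (apply f (act (e ♯) q)) (apply f q) (h q o) (hp q o))
    where
    late : ¬ (x′ ≤ m × t ≤ settlingTime k + suc x′)
    late (x′≤m , le) = ℕ.<⇒≱ lt (ℕ.≤-trans le (ℕ.+-monoʳ-≤ (settlingTime k) (s≤s x′≤m)))

    final : ∀ r z → LowerAction z x x′ → (iter r ≡ bot → x′ ≤ m → t ≤ settlingTime k + suc x′) →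
            LowerAction (iter r · z) x x′
    final bot  z lz hb = λ x′≤m → late (x′≤m , hb refl x′≤m)
    final inc  z lz hb = λ x′≤m → late (x′≤m , hb refl x′≤m)
    final idle z lz hb = lz
    final set  z lz hb = tt

  progress-step : ∀ {k t} {e : Cascade k} {c c′ c″} → Lower e c c′ → Progress t e c c′ → Lower e c′ c″ →
                  Progress (suc t) e c c″
  progress-step {zero} _ _ _ = tt
  progress-step {suc k} {t} {e , f} {_ , x} {_ , x′} {_ , x″} (l , h) (p , hp) (l′ , h′) = progress-step {k} l p l′ , advance
    where
    increase : ∀ r → LowerAction r x′ x″ → iter r ≡ bot → x″ ≤ m → x′ < x″
    increase bot la _ le = ⊥-elim (la le)
    increase inc la _ le = la le

    advance : ∀ q → Over q _ → iter (apply f (act (e ♯) q)) ≡ bot → x″ ≤ m → suc t ≤ settlingTime k + suc x″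
    -- As long as the lower levels may be moving, the bound is trivial. Afterwards the state `e ♯ q`
    -- is valid before the new copy, and its action increases the counter.
    advance q o eq x″≤m with ℕ.≤-<-connex t (settlingTime k)
    ... | inj₁ t≤ = ℕ.≤-trans (s≤s (ℕ.≤-trans t≤ (ℕ.m≤m+n _ x″))) (ℕ.≤-reflexive (sym (ℕ.+-suc _ x″)))
    ... | inj₂ lt = ℕ.≤-trans (s≤s (hp q o eq (ℕ.<⇒≤ (ℕ.<-≤-trans x′<x″ x″≤m))))
        (ℕ.≤-trans (ℕ.≤-reflexive (sym (ℕ.+-suc _ (suc x′)))) (ℕ.+-monoʳ-≤ (settlingTime k) (s≤s x′<x″)))
      where
      x′<x″ : x′ < x″
      x′<x″ = increase (apply f (act (e ♯) q))
        (h′ (act (e ♯) q) (lower-act {k} q (progress⇒lower-♯ {k} lt l p) o)) eq x″≤m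

  module _ {k n : ℕ} (slow : settlingTime k ≤ n) where
    open StabilizationSemigroup (cascade k) using (Tree; leaf; binary; idempotent; stabilization; Forest; one; _∷_)

    lower-tree : ∀ {u s c c′} → Tree n u s → Path Lower (toList u) c c′ → Lower s c c′
    lower-forest : ∀ {u e j c c′} → e ⊙ e ≡ e → Forest n e j u → Path Lower (toList u) c c′ →
                   Lower e c c′ × Progress j e c c′

    lower-tree (leaf s) (_ , refl , l) = l
    lower-tree (binary {u} t t′) p =
      let _ , p , p′ = path-++ (toList u) p in lower-⊙ {k} (lower-tree t p′) (lower-tree t′ p)
    lower-tree (idempotent i _ ts) p = proj₁ (lower-forest i ts p)
    lower-tree (stabilization i n<j ts) p =
      let l , pr = lower-forest i ts p in progress⇒lower-♯ {k} (ℕ.≤-<-trans slow n<j) l pr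

    lower-forest i (one t) p = lower-tree t p , progress-one {k}
    lower-forest i (_∷_ {u} t ts) p =
      let _ , p , p′ = path-++ (toList u) p
          l , pr     = lower-forest i ts p
          l′         = lower-tree t p′
      in subst (λ s → Lower s _ _) i (lower-⊙ {k} l′ l) , progress-step {k} l pr l′

-- From formulas to cascades

require : Bool → Action
require b = if b then set else bot

until : Bool → Bool → Action → Action
until b c x = if b then set else if c then idle else x

require-mono : ∀ {b b′} → (T b → T b′) → require b ⊑ require b′
require-mono {false}        _ = z≤n
require-mono {true} {true}  _ = ℕ.≤-refl
require-mono {true} {false} f = ⊥-elim (f tt)

until-mono : ∀ {b b′ c c′ x} → x ⊑ idle → (T b → T b′) → (T c → T c′) → until b c x ⊑ until b′ c′ x
until-mono {true}  {true}  _ _ _ = ℕ.≤-refl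
until-mono {true}  {false} _ f _ = ⊥-elim (f tt)
until-mono {false} {true} {false} l _ _ = ℕ.≤-trans l (ℕ.n≤1+n 2)
until-mono {false} {true} {true}  _ _ _ = ℕ.n≤1+n 2
until-mono {false} {false} {false} {false} _ _ _ = ℕ.≤-refl
until-mono {false} {false} {false} {true}  l _ _ = l
until-mono {false} {false} {true}  {true}  _ _ _ = ℕ.≤-refl
until-mono {false} {false} {true}  {false} _ _ f = ⊥-elim (f tt)

does⁺ : {P : Set} (P? : Dec P) → P → T (does P?)
does⁺ (yes _) _ = tt
does⁺ (no ¬p) p = ¬p p

does⁻ : {P : Set} (P? : Dec P) → T (does P?) → P
does⁻ (yes p) _ = p

module Translation {A : Set} (finite : Finite A) where
  open Semantics finite

  Operands : List (LTL≤ A) → LTL≤ A → Set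
  Operands Γ (atom a)   = ⊤
  Operands Γ Ω          = ⊤
  Operands Γ (X φ)      = φ ∈ Γ
  Operands Γ (φ ∧ ψ)    = φ ∈ Γ × ψ ∈ Γ
  Operands Γ (φ ∨ ψ)    = φ ∈ Γ × ψ ∈ Γ
  Operands Γ (φ U ψ)    = φ ∈ Γ × ψ ∈ Γ
  Operands Γ (φ U≤N ψ)  = φ ∈ Γ × ψ ∈ Γ

  -- The head of the list is the top of the cascade, so operands in the tail are components that an
  -- update may consult.
  data Closed : List (LTL≤ A) → Set where
    []  : Closed []
    _∷_ : ∀ {φ Γ} → Operands Γ φ → Closed Γ → Closed (φ ∷ Γ)

  Extension : List (LTL≤ A) → LTL≤ A → Set
  Extension Γ φ = ∃[ Δ ] Closed Δ × (∀ {χ} → χ ∈ Γ → χ ∈ Δ) × φ ∈ Δ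

  closure : ∀ φ {Γ} → Closed Γ → Extension Γ φ
  closure₂ : ∀ φ ψ {χ Γ} → (∀ {Δ} → φ ∈ Δ × ψ ∈ Δ → Operands Δ χ) → Closed Γ → Extension Γ χ

  closure (atom a)  c = _ , tt ∷ c , there , here refl
  closure Ω         c = _ , tt ∷ c , there , here refl
  closure (X φ)     c = let _ , c , w , i = closure φ c in _ , i ∷ c , there ∘ w , here refl
  closure (φ ∧ ψ)   c = closure₂ φ ψ (λ i → i) c
  closure (φ ∨ ψ)   c = closure₂ φ ψ (λ i → i) c
  closure (φ U ψ)   c = closure₂ φ ψ (λ i → i) c
  closure (φ U≤N ψ) c = closure₂ φ ψ (λ i → i) c

  closure₂ φ ψ ops c =
    let _ , c , w , i  = closure φ c
        _ , c , w′ , j = closure ψ c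
    in _ , ops (w′ i , j) ∷ c , there ∘ w′ ∘ w , here refl

  component : ∀ {φ : LTL≤ A} {Γ} → φ ∈ Γ → State (length Γ) → Bool
  component (here _)  (_ , b) = b
  component (there i) (q , _) = component i q

  component-mono : ∀ {φ : LTL≤ A} {Γ} (i : φ ∈ Γ) {q q′} → q ≼ q′ → T (component i q) → T (component i q′)
  component-mono (here _)  (_ , h) = h
  component-mono (there i) (l , _) = component-mono i l

  -- The action of the letter a on the counter of φ, given the truth values of
  -- the operands before (q) and after (p) reading a.
  action : A → ∀ φ {Γ} → Operands Γ φ → State (length Γ) → State (length Γ) → Action
  action a (atom b)  _       q p = require (does (finite⇒≟ finite a b))
  action a Ω         _       q p = bot
  action a (X φ)     i       q p = require (component i q)
  action a (φ ∧ ψ)   (i , j) q p = require (component i p && component j p)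
  action a (φ ∨ ψ)   (i , j) q p = require (component i p || component j p)
  action a (φ U ψ)   (i , j) q p = until (component j p) (component i p) bot
  action a (φ U≤N ψ) (i , j) q p = until (component j p) (component i p) inc

  action-mono : ∀ a φ {Γ} (ops : Operands Γ φ) {q q′ p p′} → q ≼ q′ → p ≼ p′ →
                action a φ ops q p ⊑ action a φ ops q′ p′
  action-mono a (atom b)  _       l m = ℕ.≤-refl
  action-mono a Ω         _       l m = ℕ.≤-refl
  action-mono a (X φ)     i       l m = require-mono (component-mono i l)
  action-mono a (φ ∧ ψ)   (i , j) l m = require-mono λ t → Equivalence.from T-∧
    (map× (component-mono i m) (component-mono j m) (Equivalence.to T-∧ t))
  action-mono a (φ ∨ ψ)   (i , j) l m = require-mono λ t → Equivalence.from T-∨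
    (map⊎ (component-mono i m) (component-mono j m) (Equivalence.to T-∨ t))
  action-mono a (φ U ψ)   (i , j) l m = until-mono z≤n (component-mono j m) (component-mono i m)
  action-mono a (φ U≤N ψ) (i , j) l m = until-mono (s≤s z≤n) (component-mono j m) (component-mono i m)

  letterImage : ∀ {Γ} → Closed Γ → A → Cascade (length Γ)
  letterImage [] a = tt
  letterImage (_∷_ {φ} {Γ} ops c) a = s , update (λ q → action a φ ops q (act s q))
    (λ l → action-mono a φ ops l (act-mono {s = s} (⊑ᶜ-refl {length Γ}) l))
    where
    s : Cascade (length Γ)
    s = letterImage c a

  apply-letterImage : ∀ {φ Γ} (ops : Operands Γ φ) (c : Closed Γ) a q →
    apply (proj₂ (letterImage (ops ∷ c) a)) q ≡ action a φ ops q (act (letterImage c a) q)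
  apply-letterImage ops c a q = lookup-tabulate _ q

  module _ (m : ℕ) where
    open Simulation m

    -- Exact counter values of the subformulas on a word.

    truth : ∀ Γ → List A → State (length Γ)
    truth []      z = tt
    truth (φ ∷ Γ) z = truth Γ z , does (z , m ⊨? φ)

    component-truth : ∀ {φ Γ} (i : φ ∈ Γ) z → component i (truth Γ z) ≡ does (z , m ⊨? φ)
    component-truth (here refl) z = refl
    component-truth (there i)   z = component-truth i z

    indicator : Bool → ℕ
    indicator b = if b then 0 else suc m

    -- Stopping at the first suffix that satisfies `ψ` is optimal, since going on can only add
    -- failures of `φ`. If there is none, the base value `suc m` plays the role of infinity.
    failures : LTL≤ A → LTL≤ A → List A → ℕ
    failures φ ψ []      = indicator (does ([] , m ⊨? ψ))
    failures φ ψ (a ∷ z) =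
      if does (a ∷ z , m ⊨? ψ) then 0 else
      if does (a ∷ z , m ⊨? φ) then failures φ ψ z else suc (failures φ ψ z)

    count : LTL≤ A → List A → ℕ
    count (φ U≤N ψ) z = failures φ ψ z
    count φ         z = indicator (does (z , m ⊨? φ))

    Within : LTL≤ A → LTL≤ A → ℕ → List A → Set
    Within φ ψ j u = ∃₂ λ y z → u ≡ y ++ z × (z , m ⊨ ψ) ×
      length (filter (λ y″ → ¬? (y″ ++ z , m ⊨? φ)) (nonEmptySuffixes y)) ≤ j

    -- The bound `j ≤ m` excludes the value `suc m`, which stands for a missing witness of `ψ`.
    failures⇒within : ∀ φ ψ {j} u → j ≤ m → failures φ ψ u ≤ j → Within φ ψ j u
    failures⇒within φ ψ [] j≤m le with [] , m ⊨? ψ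
    ... | yes s = [] , [] , refl , s , z≤n
    ... | no  _ = ⊥-elim (ℕ.<⇒≱ le j≤m)
    failures⇒within φ ψ (a ∷ u) j≤m le with a ∷ u , m ⊨? ψ | a ∷ u , m ⊨? φ
    ... | yes s | _     = [] , a ∷ u , refl , s , z≤n
    ... | no  _ | yes t with failures⇒within φ ψ u j≤m le
    ...   | y , z , refl , s , few = a ∷ y , z , refl , s , ℕ.≤-trans (ℕ.≤-reflexive (cong length
              (filter-reject (λ y″ → ¬? (y″ ++ z , m ⊨? φ)) {a ∷ y} (λ ¬t → ¬t t)))) few
    failures⇒within φ ψ {suc j} (a ∷ u) j≤m (s≤s le) | no _ | no ¬t
        with failures⇒within φ ψ u (ℕ.≤-trans (ℕ.n≤1+n j) j≤m) le
    ...   | y , z , refl , s , few = a ∷ y , z , refl , s , ℕ.≤-trans (ℕ.≤-reflexive (cong length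
              (filter-accept (λ y″ → ¬? (y″ ++ z , m ⊨? φ)) {a ∷ y} ¬t))) (s≤s few)

    within⇒failures : ∀ φ ψ {j} u → Within φ ψ j u → failures φ ψ u ≤ j
    within⇒failures φ ψ [] ([] , [] , refl , s , _) with [] , m ⊨? ψ
    ... | yes _ = z≤n
    ... | no ¬s = ⊥-elim (¬s s)
    within⇒failures φ ψ (a ∷ u) w with a ∷ u , m ⊨? ψ | a ∷ u , m ⊨? φ
    within⇒failures φ ψ (a ∷ u) w | yes _ | _ = z≤n
    within⇒failures φ ψ (a ∷ u) ([] , _ , refl , s , _) | no ¬s | _ = ⊥-elim (¬s s)
    within⇒failures φ ψ (a ∷ u) (.a ∷ y , z , refl , s , few) | no _ | yes t =
      within⇒failures φ ψ u (y , z , refl , s , ℕ.≤-trans (ℕ.≤-reflexive (cong length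
        (sym (filter-reject (λ y″ → ¬? (y″ ++ z , m ⊨? φ)) {a ∷ y} (λ ¬t → ¬t t))))) few)
    within⇒failures φ ψ (a ∷ u) (.a ∷ y , z , refl , s , few) | no _ | no ¬t =
      less (ℕ.≤-trans (ℕ.≤-reflexive (cong length
        (sym (filter-accept (λ y″ → ¬? (y″ ++ z , m ⊨? φ)) {a ∷ y} ¬t)))) few)
      where
      less : ∀ {j} → suc (length (filter (λ y″ → ¬? (y″ ++ z , m ⊨? φ)) (nonEmptySuffixes y))) ≤ j →
             suc (failures φ ψ u) ≤ j
      less (s≤s few) = s≤s (within⇒failures φ ψ u (y , z , refl , s , few))

    indicator-yes : ∀ φ {z} → z , m ⊨ φ → indicator (does (z , m ⊨? φ)) ≡ 0
    indicator-yes φ {z} s = cong indicator (dec-true (z , m ⊨? φ) s)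

    indicator-no : ∀ φ {z} → ¬ (z , m ⊨ φ) → indicator (does (z , m ⊨? φ)) ≡ suc m
    indicator-no φ {z} ¬s = cong indicator (dec-false (z , m ⊨? φ) ¬s)

    indicator⇒⊨ : ∀ φ {z} → indicator (does (z , m ⊨? φ)) ≤ m → z , m ⊨ φ
    indicator⇒⊨ φ {z} le with z , m ⊨? φ
    ... | yes s = s
    ... | no _  = ⊥-elim (ℕ.<⇒≱ le ℕ.≤-refl)

    count⇒⊨ : ∀ φ {z} → count φ z ≤ m → z , m ⊨ φ
    count⇒⊨ (φ U≤N ψ) le = failures⇒within φ ψ _ ℕ.≤-refl le
    count⇒⊨ (atom a)  le = indicator⇒⊨ (atom a) le
    count⇒⊨ Ω         le = indicator⇒⊨ Ω le
    count⇒⊨ (X φ)     le = indicator⇒⊨ (X φ) le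
    count⇒⊨ (φ ∧ ψ)   le = indicator⇒⊨ (φ ∧ ψ) le
    count⇒⊨ (φ ∨ ψ)   le = indicator⇒⊨ (φ ∨ ψ) le
    count⇒⊨ (φ U ψ)   le = indicator⇒⊨ (φ U ψ) le

    ⊨⇒indicator : ∀ φ {z} → z , m ⊨ φ → indicator (does (z , m ⊨? φ)) ≤ m
    ⊨⇒indicator φ s = ℕ.≤-trans (ℕ.≤-reflexive (indicator-yes φ s)) z≤n

    ⊨⇒count : ∀ φ {z} → z , m ⊨ φ → count φ z ≤ m
    ⊨⇒count (φ U≤N ψ) s = within⇒failures φ ψ _ s
    ⊨⇒count (atom a)  s = ⊨⇒indicator (atom a) s
    ⊨⇒count Ω         s = ⊨⇒indicator Ω s
    ⊨⇒count (X φ)     s = ⊨⇒indicator (X φ) s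
    ⊨⇒count (φ ∧ ψ)   s = ⊨⇒indicator (φ ∧ ψ) s
    ⊨⇒count (φ ∨ ψ)   s = ⊨⇒indicator (φ ∨ ψ) s
    ⊨⇒count (φ U ψ)   s = ⊨⇒indicator (φ U ψ) s

    count-[] : ∀ φ → [] , m ⊨ φ → count φ [] ≡ 0
    count-[] (φ U≤N ψ) ([] , [] , refl , s , _) = indicator-yes ψ s
    count-[] (atom a)  s = indicator-yes (atom a) s
    count-[] Ω         s = indicator-yes Ω s
    count-[] (X φ)     s = indicator-yes (X φ) s
    count-[] (φ ∧ ψ)   s = indicator-yes (φ ∧ ψ) s
    count-[] (φ ∨ ψ)   s = indicator-yes (φ ∨ ψ) s
    count-[] (φ U ψ)   s = indicator-yes (φ U ψ) s

    Exact : Action → ℕ → ℕ → Set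
    Exact bot  x x′ = m < x′
    Exact inc  x x′ = x′ ≡ suc x
    Exact idle x x′ = x′ ≡ x
    Exact set  x x′ = x′ ≡ 0

    exact-require : ∀ b x → Exact (require b) x (indicator b)
    exact-require true  x = refl
    exact-require false x = ℕ.≤-refl

    U-unfold : ∀ φ ψ a z → (a ∷ z , m ⊨ φ) → z , m ⊨ φ U ψ → a ∷ z , m ⊨ φ U ψ
    U-unfold φ ψ a _ t (y , z , refl , s , ts) = a ∷ y , z , refl , s , t All.∷ ts

    exact-action : ∀ {Γ} a φ (ops : Operands Γ φ) z →
      Exact (action a φ ops (truth Γ z) (truth Γ (a ∷ z))) (count φ z) (count φ (a ∷ z))
    exact-action a (atom b)  _       z = exact-require (does (finite⇒≟ finite a b)) _
    exact-action a Ω         _       z = ℕ.≤-refl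
    exact-action a (X φ)     i       z rewrite component-truth {φ} i z =
      exact-require (does (z , m ⊨? φ)) _
    exact-action a (φ ∧ ψ)   (i , j) z rewrite component-truth {φ} i (a ∷ z) | component-truth {ψ} j (a ∷ z) =
      exact-require (does (a ∷ z , m ⊨? φ ∧ ψ)) _
    exact-action a (φ ∨ ψ)   (i , j) z rewrite component-truth {φ} i (a ∷ z) | component-truth {ψ} j (a ∷ z) =
      exact-require (does (a ∷ z , m ⊨? φ ∨ ψ)) _
    exact-action a (φ U≤N ψ) (i , j) z rewrite component-truth {φ} i (a ∷ z) | component-truth {ψ} j (a ∷ z)
      with does (a ∷ z , m ⊨? ψ) | does (a ∷ z , m ⊨? φ)
    ... | true  | _     = refl
    ... | false | true  = refl
    ... | false | false = refl
    exact-action a (φ U ψ)   (i , j) z rewrite component-truth {φ} i (a ∷ z) | component-truth {ψ} j (a ∷ z) =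
      by-cases (a ∷ z , m ⊨? ψ) (a ∷ z , m ⊨? φ) (z , m ⊨? φ U ψ)
      where
      by-cases : (d : Dec (a ∷ z , m ⊨ ψ)) (e : Dec (a ∷ z , m ⊨ φ)) (f : Dec (z , m ⊨ φ U ψ)) →
        Exact (until (does d) (does e) bot) (indicator (does f)) (count (φ U ψ) (a ∷ z))
      by-cases (yes s) _ _ = indicator-yes (φ U ψ) ([] , a ∷ z , refl , s , All.[])
      by-cases (no ¬s) (yes t) (yes r) = indicator-yes (φ U ψ) (U-unfold φ ψ a z t r)
      by-cases (no ¬s) (yes t) (no ¬r) = indicator-no (φ U ψ)
        λ { ([] , _ , refl , s , _) → ¬s s
          ; (_ ∷ y , z , refl , s , _ All.∷ ts) → ¬r (y , z , refl , s , ts) }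
      by-cases (no ¬s) (no ¬t) _ = ℕ.≤-reflexive (sym (indicator-no (φ U ψ)
        λ { ([] , _ , refl , s , _) → ¬s s
          ; (_ ∷ y , z , refl , s , t All.∷ _) → ¬t t }))

    exact⇒upper : ∀ {a b x x′} → a ⊑ b → Exact b x x′ → UpperAction 1 a x x′
    exact⇒upper {bot} _ _ = tt
    exact⇒upper {inc}  {inc}  _ refl = ℕ.≤-refl
    exact⇒upper {inc}  {idle} _ refl = ℕ.n≤1+n _
    exact⇒upper {inc}  {set}  _ refl = z≤n
    exact⇒upper {idle} {idle} _ refl = ℕ.≤-refl
    exact⇒upper {idle} {set}  _ refl = z≤n
    exact⇒upper {set}  {set}  _ refl = z≤n
    exact⇒upper {idle} {inc} (s≤s ())
    exact⇒upper {set}  {inc} (s≤s ())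
    exact⇒upper {set}  {idle} (s≤s (s≤s ()))

    exact⇒lower : ∀ {a b x x′} → b ⊑ a → Exact b x x′ → LowerAction a x x′
    exact⇒lower {set} _ _ = tt
    exact⇒lower {bot}  {bot}  _ lt   = ℕ.<⇒≱ lt
    exact⇒lower {inc}  {bot}  _ lt   = ⊥-elim ∘ ℕ.<⇒≱ lt
    exact⇒lower {inc}  {inc}  _ refl = λ _ → ℕ.≤-refl
    exact⇒lower {idle} {bot}  _ lt   = ⊥-elim ∘ ℕ.<⇒≱ lt
    exact⇒lower {idle} {inc}  _ refl = λ _ → ℕ.n≤1+n _
    exact⇒lower {idle} {idle} _ refl = λ _ → ℕ.≤-refl
    exact⇒lower {inc}  {idle} (s≤s ())
    exact⇒lower {inc}  {set}  (s≤s ())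
    exact⇒lower {idle} {set}  (s≤s (s≤s ()))

    counters : ∀ Γ → List A → Counters (length Γ)
    counters []      z = tt
    counters (φ ∷ Γ) z = counters Γ z , count φ z

    under⇒≼truth : ∀ {Γ K q z} → Under K q (counters Γ z) → q ≼ truth Γ z
    under⇒≼truth {[]}    _       = tt
    under⇒≼truth {φ ∷ Γ} {K} {z = z} (u , h) = under⇒≼truth {Γ} u ,
      λ t → does⁺ (z , m ⊨? φ) (count⇒⊨ φ (ℕ.≤-trans (ℕ.m≤n+m _ K) (h t)))

    over⇒truth≼ : ∀ {Γ q z} → Over q (counters Γ z) → truth Γ z ≼ q
    over⇒truth≼ {[]}    _       = tt
    over⇒truth≼ {φ ∷ Γ} {z = z} (o , h) = over⇒truth≼ {Γ} o , λ t → h (⊨⇒count φ (does⁻ (z , m ⊨? φ) t))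

    -- A state under the counters lies below the true one, so the action it triggers lies below the
    -- exact one and promises less. The room `1 ≤ m` is for the error of the letter on the operands.
    upper-letter : ∀ {Γ} (c : Closed Γ) a z → 1 ≤ m → Upper 1 (letterImage c a) (counters Γ z) (counters Γ (a ∷ z))
    upper-letter [] a z _ = tt
    upper-letter (_∷_ {φ} {Γ} ops c) a z 1≤m = u , λ q un →
      subst (λ x → UpperAction 1 x _ _) (sym (apply-letterImage ops c a q))
        (exact⇒upper (action-mono a φ ops (under⇒≼truth {Γ} un)
          (under⇒≼truth {Γ} (upper-act {length Γ} {0} q 1≤m u un))) (exact-action a φ ops z))
      where
      u : Upper 1 (letterImage c a) (counters Γ z) (counters Γ (a ∷ z))
      u = upper-letter c a z 1≤m

    lower-letter : ∀ {Γ} (c : Closed Γ) a z → Lower (letterImage c a) (counters Γ z) (counters Γ (a ∷ z))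
    lower-letter [] a z = tt
    lower-letter (_∷_ {φ} {Γ} ops c) a z = l , λ q o →
      subst (λ x → LowerAction x _ _) (sym (apply-letterImage ops c a q))
        (exact⇒lower (action-mono a φ ops (over⇒truth≼ {Γ} o)
          (over⇒truth≼ {Γ} (lower-act {length Γ} q l o))) (exact-action a φ ops z))
      where
      l : Lower (letterImage c a) (counters Γ z) (counters Γ (a ∷ z))
      l = lower-letter c a z

    path-map : ∀ {Γ} (c : Closed Γ) {R} → (∀ a z → R (letterImage c a) (counters Γ z) (counters Γ (a ∷ z))) →
               ∀ u → Path R (map (letterImage c) u) (counters Γ []) (counters Γ u)
    path-map c r []      = refl
    path-map c r (a ∷ u) = _ , path-map c r u , r a u

    component-under : ∀ {φ Γ q z} (i : φ ∈ Γ) → Under 0 q (counters Γ z) → T (component i q) → z , m ⊨ φ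
    component-under {Γ = Γ} {z = z} i un t = does⁻ (z , m ⊨? _)
      (subst T (component-truth i z) (component-mono i (under⇒≼truth {Γ} un) t))

    component-over : ∀ {φ Γ q z} (i : φ ∈ Γ) → Over q (counters Γ z) → z , m ⊨ φ → T (component i q)
    component-over {Γ = Γ} {z = z} i o s =
      component-mono i (over⇒truth≼ {Γ} o) (subst T (sym (component-truth i z)) (does⁺ (z , m ⊨? _) s))

    ⊨[]-stable : ∀ φ {n n′} → [] , n ⊨ φ → [] , n′ ⊨ φ
    ⊨[]-stable φ = ⊨-stable φ (inj₂ z≤n)

  -- On the empty word satisfaction does not depend on the parameter, so the value 0 serves every
  -- threshold.
  initial : ∀ Γ → State (length Γ)
  initial Γ = truth 0 Γ []

  under-initial : ∀ m Γ {K} → K ≤ m → Simulation.Under m K (initial Γ) (counters m Γ [])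
  under-initial m []      le = tt
  under-initial m (φ ∷ Γ) {K} le = under-initial m Γ le , λ t → ℕ.≤-trans
    (ℕ.≤-reflexive (trans (cong (K +_) (count-[] m φ (⊨[]-stable m φ (does⁻ ([] , 0 ⊨? φ) t)))) (ℕ.+-identityʳ K))) le

  over-initial : ∀ m Γ → Simulation.Over m (initial Γ) (counters m Γ [])
  over-initial m []      = tt
  over-initial m (φ ∷ Γ) = over-initial m Γ , λ le → does⁺ ([] , 0 ⊨? φ) (⊨[]-stable m φ (count⇒⊨ m φ le))

-- Recognition

open StabilizationSemigroup using (Carrier; NeutralStable; Aperiodic; Ideal; IsValuation)

isInf-<⇒ : ∀ {P : Pred ℕ 0ℓ} {v N} → IsInf P v → v <⁺ [ N ] → ∃[ n ] n < N × P n
isInf-<⇒ (minimum p _) StrictSup.[ lt ] = _ , lt , p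

isInf-⇒< : ∀ {P : Pred ℕ 0ℓ} {v n} → IsInf P v → P n → v <⁺ [ suc n ]
isInf-⇒< (minimum _ min) p = StrictSup.[ s≤s (min _ p) ]
isInf-⇒< (empty none)    p = ⊥-elim (none _ p)

inf-exists : ∀ {P : Pred ℕ 0ℓ} → Decidable P → Dec (∃ P) → Σ[ v ∈ ℕ∞ ] IsInf P v
inf-exists P? (no none) = ⊤⁺ , empty λ n p → none (n , p)
inf-exists P? (yes (n , p)) with least P? (suc n)
... | inj₁ (l , q , min) = [ l ] , minimum q min
... | inj₂ none          = ⊥-elim (none n ℕ.≤-refl p)

-- `α` and `β` are correction functions: they transform a bound on one infimum into a bound on the
-- other, uniformly in `x`.
≈-inf : ∀ {X : Set} {P Q : X → Pred ℕ 0ℓ} {f g : X → ℕ∞} →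
        (∀ x → IsInf (P x) (f x)) → (∀ x → IsInf (Q x) (g x)) → (α β : ℕ → ℕ) →
        (∀ x N {n} → n < N → P x n → Q x (α N)) → (∀ x N {n} → n < N → Q x n → P x (β N)) → f ≈ g
≈-inf infP infQ α β P⇒Q Q⇒P W = mk⇔
  (λ (N , b) → suc (α N) , λ x x∈W → let _ , lt , p = isInf-<⇒ (infP x) (b x x∈W) in
    isInf-⇒< (infQ x) (P⇒Q x N lt p))
  (λ (N , b) → suc (β N) , λ x x∈W → let _ , lt , q = isInf-<⇒ (infQ x) (b x x∈W) in
    isInf-⇒< (infP x) (Q⇒P x N lt q))

module Recognition {A : Set} (finite : Finite A) (φ : LTL≤ A) where
  open Semantics finite
  open Translation finite

  Γ : List (LTL≤ A)
  Γ = proj₁ (closure φ [])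

  closed : Closed Γ
  closed = proj₁ (proj₂ (closure φ []))

  φ∈Γ : φ ∈ Γ
  φ∈Γ = proj₂ (proj₂ (proj₂ (closure φ [])))

  k : ℕ
  k = length Γ

  h : A → Cascade k
  h = letterImage closed

  Accepting : Cascade k → Set
  Accepting s = T (component φ∈Γ (act s (initial Γ)))

  rejecting : Ideal (cascade k)
  rejecting = record
    { member     = ¬_ ∘ Accepting
    ; downClosed = λ s⊑t ¬acc acc → ¬acc (component-mono φ∈Γ (act-mono {k} s⊑t ≼-refl) acc)
    }

  open Trees (cascade k)
  open Factorization (cascade k) (cascade-identity k) (k , cascade-aperiodic k)

  tree-accepting⇒⊨ : ∀ {n H u s} → TreeWithin n H (List⁺.map h u) s → Accepting s → toList u , (2 + n) ^ H ⊨ φ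
  tree-accepting⇒⊨ {n} {H} {u} (t , l) acc = component-under m {Γ = Γ} φ∈Γ
    (upper-act {k} {0} (initial Γ) ℕ.≤-refl
      (upper-tree t l ℕ.≤-refl (path-map m closed (λ a z → upper-letter m closed a z (ℕ.m^n>0 (2 + n) H)) (toList u)))
      (under-initial m Γ ℕ.≤-refl)) acc
    where
    -- The threshold equals the error of the tree: the initial counters of true formulas are 0,
    -- which leaves exactly this much slack.
    m : ℕ
    m = (2 + n) ^ H
    open Simulation m

  ⊨⇒tree-accepting : ∀ {m n u s} → Simulation.settlingTime m k ≤ n →
    StabilizationSemigroup.Tree (cascade k) n (List⁺.map h u) s → toList u , m ⊨ φ → Accepting s
  ⊨⇒tree-accepting {m} {u = u} slow t sat = component-over m {Γ = Γ} φ∈Γ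
    (lower-act {k} (initial Γ) (lower-tree slow t (path-map m closed (lower-letter m closed) (toList u)))
      (over-initial m Γ)) sat
    where open Simulation m

  H : ℕ
  H = proj₁ factorization

  abstract
    ρ,isValuation : Σ[ ρ ∈ _ ] IsValuation (cascade k) H ρ
    ρ,isValuation = valuation (_⊑ᶜ?_ {k}) H (proj₂ factorization)

  ρ : List⁺ (Cascade k) → ℕ → Cascade k
  ρ = proj₁ ρ,isValuation

  -- The double negation comes from the complement of an ideal that is itself a complement;
  -- decidability of acceptance removes it.
  NotRejecting : List⁺ A → Pred ℕ 0ℓ
  NotRejecting u n = ¬ ¬ Accepting (ρ (List⁺.map h u) n)

  tree : ∀ u n → TreeWithin n H u (ρ u n)
  tree = IsValuation.attained (proj₂ ρ,isValuation)

  notRejecting⇒⊨ : ∀ u {n} → NotRejecting u n → toList u , (2 + n) ^ H ⊨ φ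
  notRejecting⇒⊨ u {n} ¬¬acc = tree-accepting⇒⊨ {u = u} (tree _ n) (decidable-stable (T? _) ¬¬acc)

  ⊨⇒notRejecting : ∀ u {m} → toList u , m ⊨ φ → NotRejecting u (Simulation.settlingTime m k)
  ⊨⇒notRejecting u sat ¬acc = ¬acc (⊨⇒tree-accepting {u = u} ℕ.≤-refl (proj₁ (tree _ _)) sat)

  infNotRejecting : ∀ u → Σ[ v ∈ ℕ∞ ] IsInf (NotRejecting u) v
  infNotRejecting u = inf-exists (λ n → ¬? (¬? (T? _))) bounded
    where
    bounded : Dec (∃ (NotRejecting u))
    -- The length of the word is a parameter that settles satisfiability for all parameters at once,
    -- which makes the unbounded search for `n` decidable.
    bounded with toList u , length (toList u) ⊨? φ
    ... | yes sat = yes (_ , ⊨⇒notRejecting u sat)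
    ... | no ¬sat = no λ (n , p) → ¬sat (⊨-stable φ (inj₂ ℕ.≤-refl) (notRejecting⇒⊨ u p))

  recognizes : ∀ {F : List⁺ A → ℕ∞} → F ≈ ⟦ φ ⟧ ∘ toList → Recognizes (cascade k) h rejecting F
  recognizes F≈ = record
    { H           = H
    ; ρ           = ρ
    ; isValuation = proj₂ ρ,isValuation
    ; g           = proj₁ ∘ infNotRejecting
    ; isInf       = proj₂ ∘ infNotRejecting
    ; f≈g         = λ W → φ≈g W ⇔-∘ F≈ W
    }
    where
    φ≈g : ⟦ φ ⟧ ∘ toList ≈ proj₁ ∘ infNotRejecting
    φ≈g = ≈-inf (proj₂ ∘ inf⊨ φ ∘ toList) (proj₂ ∘ infNotRejecting)
      (λ N → Simulation.settlingTime N k) (λ N → (2 + N) ^ H)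
      (λ u N n<N sat → ⊨⇒notRejecting u (⊨-stable φ (inj₁ (ℕ.<⇒≤ n<N)) sat))
      (λ u N n<N p → ⊨-stable φ (inj₁ (ℕ.^-monoˡ-≤ H (s≤s (s≤s (ℕ.<⇒≤ n<N))))) (notRejecting⇒⊨ u p))

-- Passage to the syntactic stabilization semigroup.

quotient-aperiodic : ∀ {A : Set} {S T : StabilizationSemigroup} {h : A → Carrier S} {h′ : A → Carrier T} →
                     Aperiodic S → Quotient S h T h′ → Aperiodic T
quotient-aperiodic {S = S} {T} {h} (k , stable) Q = k , λ x → periodic (Q .onto x)
  where
  open Quotient
  module S = StabilizationSemigroup S
  module T = StabilizationSemigroup T
  module ≤S = IsPartialOrder S.isPartialOrder
  module ≤T = IsPartialOrder T.isPartialOrder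

  η-cong : ∀ {s t} (p : Generated S h s) (q : Generated S h t) → s ≡ t → Q .η p ≡ Q .η q
  η-cong p q s≡t = ≤T.antisym (Q .mono p q (≤S.reflexive s≡t)) (Q .mono q p (≤S.reflexive (sym s≡t)))

  power : ∀ {s} → Generated S h s → ∀ j → Generated S h (s S.^1+ j)
  power p zero    = p
  power p (suc j) = product p (power p j)

  η-power : ∀ {s} (p : Generated S h s) j → Q .η (power p j) ≡ Q .η p T.^1+ j
  η-power p zero    = refl
  η-power p (suc j) = trans (Q .η-∙ p (power p j)) (cong (Q .η p T.∙_) (η-power p j))

  periodic : ∀ {x} → ∃₂ (λ s (p : Generated S h s) → Q .η p ≡ x) → x T.^1+ suc k ≡ x T.^1+ k
  periodic (s , p , refl) = trans (sym (η-power p (suc k)))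
    (trans (η-cong (power p (suc k)) (power p k) (stable s)) (η-power p k))

theorem8p2 : {A : Set} (finite : Finite A) (φ : LTL≤ A) (F : List⁺ A → ℕ∞) →
    F ≈ Semantics.⟦_⟧ finite φ ∘ toList →
    Regular F × (∀ T → IsSyntactic T F → StabilizationSemigroup.Aperiodic T)
theorem8p2 finite φ F F≈ =
  (cascade k , cascade-neutralStable k , h , rejecting , recognizes F≈) ,
  λ T syn → quotient-aperiodic (k , cascade-aperiodic k)
    (IsSyntactic.quotient syn (cascade k) (cascade-neutralStable k) h rejecting (recognizes F≈))
  where open Recognition finite φ
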